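{- The following series identity holds: $$\sum_{k=0}^{\infty}\frac{2+3k}{(-8)^k}\,\frac{(1)_k^3}{(\frac{3}{2})_k^3}\left\{H_{1+2k}^{(2)}-\frac{5}{4}H_{k}^{(2)}\right\}=2\beta(4).$$
   Context: For a complex number $x$ and a nonnegative integer $n$, the shifted factorial is $(x)_0=1$ and $(x)_n=x(x+1)\cdots(x+n-1)$ for $n\ge 1$; $(x)_n^m$ denotes $((x)_n)^m$. The harmonic numbers of order 2 are $H_n^{(2)}=\sum_{j=1}^n \frac{1}{j^2}$, with $H_0^{(2)}=0$. The constant $\beta(4)$ is $\beta(4)=\sum_{k=0}^{\infty}\frac{(-1)^k}{(1+2k)^4}$. -}

module Defs where

open import Algebra.Bundles using (CommutativeRing)
import Algebra.Properties.Semiring.Exp as Exp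
open import Data.Integer.Base as ℤ using (+_; -[1+_])
import Data.Integer.Properties as ℤ
open import Data.Nat.Base as ℕ using (ℕ; zero; suc)
import Data.Nat.Properties as ℕ
open import Data.Product.Base using (Σ; ∃-syntax; _×_; _,_; proj₁; proj₂)
open import Data.Rational.Base hiding (_⊔_)
open import Data.Rational.Properties
open import Data.Rational.Solver using (module +-*-Solver)
import Data.Rational.Unnormalised.Base as ℚᵘ
import Data.Rational.Unnormalised.Properties as ℚᵘ
open import Data.Sum.Base using (inj₁; inj₂)
open import Relation.Binary.PropositionalEquality
  using (_≡_; refl; sym; trans; cong; cong₂; subst; module ≡-Reasoning)

open Exp (CommutativeRing.semiring +-*-commutativeRing) public using (_^_)

fromℕ : ℕ → ℚ
fromℕ n = + n / 1

∑< : ℕ → (ℕ → ℚ) → ℚ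
∑< zero    f = 0ℚ
∑< (suc n) f = ∑< n f + f n

private
  ½+½ : ∀ ε → ½ * ε + ½ * ε ≡ ε
  ½+½ ε = trans (sym (*-distribʳ-+ ε ½ ½)) (*-identityˡ ε)

  ½-pos : ∀ {ε} → 0ℚ < ε → 0ℚ < ½ * ε
  ½-pos {ε} 0<ε = positive⁻¹ (½ * ε) {{pos*pos⇒pos ½ ε {{positive 0<ε}}}}

  neg-sub : ∀ p q → - (p - q) ≡ q - p
  neg-sub = solve 2 (λ p q → :- (p :- q) := q :- p) refl
    where open +-*-Solver

  ∣-∣-≤ : ∀ {p q} → p ≤ q → - p ≤ q → ∣ p ∣ ≤ q
  ∣-∣-≤ {p} p≤q -p≤q with ∣p∣≡p∨∣p∣≡-p p
  ... | inj₁ eq = ≤-trans (≤-reflexive eq) p≤q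
  ... | inj₂ eq = ≤-trans (≤-reflexive eq) -p≤q

  ∣p-q∣≡∣q-p∣ : ∀ p q → ∣ p - q ∣ ≡ ∣ q - p ∣
  ∣p-q∣≡∣q-p∣ p q = trans (sym (∣-p∣≡∣p∣ (p - q))) (cong ∣_∣ (neg-sub p q))

  ∣p∣-∣q∣≤∣p-q∣ : ∀ p q → ∣ p ∣ - ∣ q ∣ ≤ ∣ p - q ∣
  ∣p∣-∣q∣≤∣p-q∣ p q = begin
    ∣ p ∣ - ∣ q ∣                ≡⟨ cong (λ z → ∣ z ∣ - ∣ q ∣) (l₁ p q) ⟩
    ∣ (p - q) + q ∣ - ∣ q ∣      ≤⟨ +-monoˡ-≤ (- ∣ q ∣) (∣p+q∣≤∣p∣+∣q∣ (p - q) q) ⟩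
    ∣ p - q ∣ + ∣ q ∣ - ∣ q ∣    ≡⟨ l₂ ∣ p - q ∣ ∣ q ∣ ⟩
    ∣ p - q ∣                    ∎
    where
    open ≤-Reasoning
    open +-*-Solver
    l₁ : ∀ p q → p ≡ (p - q) + q
    l₁ = solve 2 (λ p q → p := (p :- q) :+ q) refl
    l₂ : ∀ p q → p + q - q ≡ p
    l₂ = solve 2 (λ p q → (p :+ q) :- q := p) refl

  ∣∣p∣-∣q∣∣≤∣p-q∣ : ∀ p q → ∣ ∣ p ∣ - ∣ q ∣ ∣ ≤ ∣ p - q ∣
  ∣∣p∣-∣q∣∣≤∣p-q∣ p q = ∣-∣-≤ (∣p∣-∣q∣≤∣p-q∣ p q) (begin
    - (∣ p ∣ - ∣ q ∣)  ≡⟨ neg-sub ∣ p ∣ ∣ q ∣ ⟩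
    ∣ q ∣ - ∣ p ∣      ≤⟨ ∣p∣-∣q∣≤∣p-q∣ q p ⟩
    ∣ q - p ∣          ≡⟨ ∣p-q∣≡∣q-p∣ q p ⟩
    ∣ p - q ∣          ∎)
    where open ≤-Reasoning

  1/-antimono : ∀ m n .{{_ : ℕ.NonZero m}} .{{_ : ℕ.NonZero n}} →
                m ℕ.≤ n → + 1 / n ≤ + 1 / m
  1/-antimono m@(suc _) n@(suc _) m≤n = toℚᵘ-cancel-≤ (begin
    toℚᵘ (+ 1 / n)  ≃⟨ toℚᵘ-fromℚᵘ (+ 1 ℚᵘ./ n) ⟩
    + 1 ℚᵘ./ n      ≤⟨ ℚᵘ.*≤* (ℤ.*-monoˡ-≤-nonNeg (+ 1) (ℤ.+≤+ m≤n)) ⟩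
    + 1 ℚᵘ./ m      ≃⟨ toℚᵘ-fromℚᵘ (+ 1 ℚᵘ./ m) ⟨
    toℚᵘ (+ 1 / m)  ∎)
    where open ℚᵘ.≤-Reasoning

  1/-archimedean : ∀ ε → 0ℚ < ε → ∃[ n ] (+ 1 / suc n ≤ ε)
  1/-archimedean (mkℚ (+ zero)    d _) (*<* (ℤ.+<+ ()))
  1/-archimedean (mkℚ -[1+ _ ]    d _) (*<* ())
  1/-archimedean (mkℚ (+ (suc a)) d _) _ = d , toℚᵘ-cancel-≤ (begin
    toℚᵘ (+ 1 / suc d)    ≃⟨ toℚᵘ-fromℚᵘ (+ 1 ℚᵘ./ suc d) ⟩
    + 1 ℚᵘ./ suc d        ≤⟨ ℚᵘ.*≤* (ℤ.*-monoʳ-≤-nonNeg (+ suc d) {+ 1} {+ suc a} (ℤ.+≤+ (ℕ.s≤s ℕ.z≤n))) ⟩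
    ℚᵘ.mkℚᵘ (+ suc a) d   ∎)
    where open ℚᵘ.≤-Reasoning

IsCauchy : (ℕ → ℚ) → Set
IsCauchy s = ∀ ε → 0ℚ < ε → ∃[ N ] (∀ m n → N ℕ.≤ m → N ℕ.≤ n → ∣ s m - s n ∣ < ε)

-- Real numbers are Cauchy sequences of rationals; two of them whose
-- difference tends to 0 represent the same number, and HasLimit respects this.
record ℝ : Set where
  constructor mkℝ
  field
    seq    : ℕ → ℚ
    cauchy : IsCauchy seq

open ℝ public

fromℚ : ℚ → ℝ
fromℚ q .seq    _       = q
fromℚ q .cauchy ε 0<ε = 0 , λ _ _ _ _ →
  subst (_< ε) (cong ∣_∣ (sym (+-inverseʳ q))) 0<ε

infixl 6 _-ℝ_

_-ℝ_ : ℝ → ℝ → ℝ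
(x -ℝ y) .seq n = seq x n - seq y n
(x -ℝ y) .cauchy ε 0<ε
  with cauchy x (½ * ε) (½-pos 0<ε) | cauchy y (½ * ε) (½-pos 0<ε)
... | M , p | N , q = M ℕ.⊔ N , λ m n M⊔N≤m M⊔N≤n → begin-strict
  ∣ (seq x m - seq y m) - (seq x n - seq y n) ∣
    ≡⟨ cong ∣_∣ (rearrange (seq x m) (seq y m) (seq x n) (seq y n)) ⟩
  ∣ (seq x m - seq x n) - (seq y m - seq y n) ∣
    ≤⟨ ∣p-q∣≤∣p∣+∣q∣ (seq x m - seq x n) (seq y m - seq y n) ⟩
  ∣ seq x m - seq x n ∣ + ∣ seq y m - seq y n ∣
    <⟨ +-mono-< (p m n (ℕ.m⊔n≤o⇒m≤o M N M⊔N≤m) (ℕ.m⊔n≤o⇒m≤o M N M⊔N≤n))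
                (q m n (ℕ.m⊔n≤o⇒n≤o M N M⊔N≤m) (ℕ.m⊔n≤o⇒n≤o M N M⊔N≤n)) ⟩
  ½ * ε + ½ * ε
    ≡⟨ ½+½ ε ⟩
  ε ∎
  where
  open ≤-Reasoning
  open +-*-Solver
  rearrange : ∀ a b c d → (a - b) - (c - d) ≡ (a - c) - (b - d)
  rearrange = solve 4 (λ a b c d → (a :- b) :- (c :- d) := (a :- c) :- (b :- d)) refl

∣_∣ℝ : ℝ → ℝ
∣ x ∣ℝ .seq n = ∣ seq x n ∣
∣ x ∣ℝ .cauchy ε 0<ε with cauchy x ε 0<ε
... | N , p = N , λ m n N≤m N≤n →
  ≤-<-trans (∣∣p∣-∣q∣∣≤∣p-q∣ (seq x m) (seq x n)) (p m n N≤m N≤n)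

infixr 7 _•_

_•_ : ℚ → ℝ → ℝ
(c • x) .seq n = c * seq x n
(c • x) .cauchy ε 0<ε with cauchy x ((1/ (∣ c ∣ + 1ℚ)) {{nz}} * ε) ε′>0
  where
  instance
    c-nonNeg : NonNegative ∣ c ∣
    c-nonNeg = ∣-∣-nonNeg c
    c+1-pos : Positive (∣ c ∣ + 1ℚ)
    c+1-pos = nonNeg+pos⇒pos ∣ c ∣ 1ℚ
    ε-pos : Positive ε
    ε-pos = positive 0<ε
  nz : NonZero (∣ c ∣ + 1ℚ)
  nz = pos⇒nonZero (∣ c ∣ + 1ℚ)
  ε′>0 : 0ℚ < (1/ (∣ c ∣ + 1ℚ)) {{nz}} * ε
  ε′>0 = positive⁻¹ _ {{pos*pos⇒pos ((1/ (∣ c ∣ + 1ℚ)) {{nz}}) {{1/pos⇒pos (∣ c ∣ + 1ℚ)}} ε}}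
... | N , p = N , λ m n N≤m N≤n → begin-strict
  ∣ c * seq x m - c * seq x n ∣
    ≡⟨ cong ∣_∣ (factor c (seq x m) (seq x n)) ⟩
  ∣ c * (seq x m - seq x n) ∣
    ≡⟨ ∣p*q∣≡∣p∣*∣q∣ c (seq x m - seq x n) ⟩
  ∣ c ∣ * ∣ seq x m - seq x n ∣
    ≤⟨ *-monoʳ-≤-nonNeg ∣ seq x m - seq x n ∣ {{∣-∣-nonNeg (seq x m - seq x n)}} c≤c+1 ⟩
  (∣ c ∣ + 1ℚ) * ∣ seq x m - seq x n ∣
    <⟨ *-monoʳ-<-pos (∣ c ∣ + 1ℚ) (p m n N≤m N≤n) ⟩
  (∣ c ∣ + 1ℚ) * (1/ (∣ c ∣ + 1ℚ) * ε)
    ≡⟨ *-assoc (∣ c ∣ + 1ℚ) (1/ (∣ c ∣ + 1ℚ)) ε ⟨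
  (∣ c ∣ + 1ℚ) * 1/ (∣ c ∣ + 1ℚ) * ε
    ≡⟨ cong (_* ε) (*-inverseʳ (∣ c ∣ + 1ℚ)) ⟩
  1ℚ * ε
    ≡⟨ *-identityˡ ε ⟩
  ε ∎
  where
  open ≤-Reasoning
  instance
    c-nonNeg : NonNegative ∣ c ∣
    c-nonNeg = ∣-∣-nonNeg c
    c+1-pos : Positive (∣ c ∣ + 1ℚ)
    c+1-pos = nonNeg+pos⇒pos ∣ c ∣ 1ℚ
    c+1-nonZero : NonZero (∣ c ∣ + 1ℚ)
    c+1-nonZero = pos⇒nonZero (∣ c ∣ + 1ℚ)
  factor : ∀ c a b → c * a - c * b ≡ c * (a - b)
  factor = solve 3 (λ c a b → c :* a :- c :* b := c :* (a :- b)) refl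
    where open +-*-Solver
  c≤c+1 : ∣ c ∣ ≤ ∣ c ∣ + 1ℚ
  c≤c+1 = ≤-trans (≤-reflexive (sym (+-identityʳ ∣ c ∣))) (+-monoʳ-≤ ∣ c ∣ (nonNegative⁻¹ 1ℚ))

-- The gap δ makes the order independent of the representing sequences:
-- the termwise condition seq x n < seq y n would also hold for some pairs
-- of representatives of one and the same real number.
infix 4 _<ℝ_

_<ℝ_ : ℝ → ℝ → Set
x <ℝ y = ∃[ δ ] (0ℚ < δ × ∃[ N ] (∀ n → N ℕ.≤ n → seq x n + δ ≤ seq y n))

HasLimit : (ℕ → ℚ) → ℝ → Set
HasLimit s x = ∀ ε → 0ℚ < ε →
  ∃[ N ] (∀ n → N ℕ.≤ n → ∣ fromℚ (s n) -ℝ x ∣ℝ <ℝ fromℚ ε)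

HasSum : (ℕ → ℚ) → ℝ → Set
HasSum f x = HasLimit (λ n → ∑< n f) x

-- Hence β4 below, given by its partial sums, is the sum of β4-term.
seq-limit : ∀ x → HasLimit (seq x) x
seq-limit x ε 0<ε with cauchy x (½ * ε) (½-pos 0<ε)
... | N , p = N , λ n N≤n → ½ * ε , ½-pos 0<ε , N , λ m N≤m →
  ≤-trans (+-monoˡ-≤ (½ * ε) (<⇒≤ (p n m N≤n N≤m))) (≤-reflexive (½+½ ε))

-- Leibniz criterion, with a rate: partial sums with index ≥ m are within a m
-- of the m-th one.
private
  module Alternating
    (a : ℕ → ℚ) (a-nonNeg : ∀ k → 0ℚ ≤ a k) (a-antitone : ∀ k → a (suc k) ≤ a k)
    (a-null : ∀ ε → 0ℚ < ε → ∃[ N ] (a N ≤ ε))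
    where

    sgn : ℕ → ℚ
    sgn k = (- 1ℚ) ^ k

    S : ℕ → ℚ
    S n = ∑< n (λ k → sgn k * a k)

    -- tail m d = Σ_{j<d} (-1)^j a_{m+j}
    tail : ℕ → ℕ → ℚ
    tail m zero    = 0ℚ
    tail m (suc d) = a m - tail (suc m) d

    tail-bounds : ∀ m d → 0ℚ ≤ tail m d × tail m d ≤ a m
    tail-bounds m zero    = ≤-refl , a-nonNeg m
    tail-bounds m (suc d) with tail-bounds (suc m) d
    ... | 0≤t , t≤a =
      ≤-trans (≤-reflexive (sym (+-inverseʳ (tail (suc m) d))))
              (+-monoˡ-≤ (- tail (suc m) d) (≤-trans t≤a (a-antitone m))) ,
      ≤-trans (+-monoʳ-≤ (a m) (neg-antimono-≤ 0≤t)) (≤-reflexive (+-identityʳ (a m)))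

    S-tail : ∀ m d → S (m ℕ.+ d) ≡ S m + sgn m * tail m d
    S-tail m zero rewrite ℕ.+-identityʳ m =
      solve 2 (λ s g → s := s :+ g :* con 0ℚ) refl (S m) (sgn m)
      where open +-*-Solver
    S-tail m (suc d) rewrite ℕ.+-suc m d =
      trans (S-tail (suc m) d)
        (solve 4 (λ s g x t → s :+ g :* x :+ (:- con 1ℚ :* g) :* t := s :+ g :* (x :- t)) refl
          (S m) (sgn m) (a m) (tail (suc m) d))
      where open +-*-Solver

    ∣sgn∣ : ∀ k → ∣ sgn k ∣ ≡ 1ℚ
    ∣sgn∣ zero    = refl
    ∣sgn∣ (suc k) = trans (∣p*q∣≡∣p∣*∣q∣ (- 1ℚ) (sgn k)) (cong (1ℚ *_) (∣sgn∣ k))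

    S-diff : ∀ m n → m ℕ.≤ n → ∣ S n - S m ∣ ≤ a m
    S-diff m n m≤n = begin
      ∣ S n - S m ∣                    ≡⟨ cong (λ i → ∣ S i - S m ∣) (ℕ.m+[n∸m]≡n m≤n) ⟨
      ∣ S (m ℕ.+ d) - S m ∣            ≡⟨ cong (λ z → ∣ z - S m ∣) (S-tail m d) ⟩
      ∣ S m + sgn m * tail m d - S m ∣ ≡⟨ cong ∣_∣ (cancel (S m) (sgn m * tail m d)) ⟩
      ∣ sgn m * tail m d ∣             ≡⟨ ∣p*q∣≡∣p∣*∣q∣ (sgn m) (tail m d) ⟩
      ∣ sgn m ∣ * ∣ tail m d ∣         ≡⟨ cong₂ _*_ (∣sgn∣ m) (0≤p⇒∣p∣≡p (proj₁ (tail-bounds m d))) ⟩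
      1ℚ * tail m d                    ≡⟨ *-identityˡ (tail m d) ⟩
      tail m d                         ≤⟨ proj₂ (tail-bounds m d) ⟩
      a m                              ∎
      where
      open ≤-Reasoning
      d : ℕ
      d = n ℕ.∸ m
      cancel : ∀ s t → s + t - s ≡ t
      cancel = solve 2 (λ s t → s :+ t :- s := t) refl
        where open +-*-Solver

    S-cauchy : IsCauchy S
    S-cauchy ε 0<ε with a-null (½ * (½ * ε)) (½-pos (½-pos 0<ε))
    ... | N , aN≤ = N , λ m n N≤m N≤n → begin-strict
      ∣ S m - S n ∣
        ≡⟨ cong ∣_∣ (via (S m) (S n) (S N)) ⟩
      ∣ (S m - S N) - (S n - S N) ∣
        ≤⟨ ∣p-q∣≤∣p∣+∣q∣ (S m - S N) (S n - S N) ⟩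
      ∣ S m - S N ∣ + ∣ S n - S N ∣
        ≤⟨ +-mono-≤ (≤-trans (S-diff N m N≤m) aN≤) (≤-trans (S-diff N n N≤n) aN≤) ⟩
      ½ * (½ * ε) + ½ * (½ * ε)
        ≡⟨ ½+½ (½ * ε) ⟩
      ½ * ε
        ≡⟨ +-identityʳ (½ * ε) ⟨
      ½ * ε + 0ℚ
        <⟨ +-monoʳ-< (½ * ε) (½-pos 0<ε) ⟩
      ½ * ε + ½ * ε
        ≡⟨ ½+½ ε ⟩
      ε ∎
      where
      open ≤-Reasoning
      via : ∀ x y z → x - y ≡ (x - z) - (y - z)
      via = solve 3 (λ x y z → x :- y := (x :- z) :- (y :- z)) refl
        where open +-*-Solver

β4-term : ℕ → ℚ
β4-term k = (- 1ℚ) ^ k * (+ 1 / (1 ℕ.+ 2 ℕ.* k) ℕ.^ 4)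

private
  den : ℕ → ℕ
  den k = (1 ℕ.+ 2 ℕ.* k) ℕ.^ 4

  den-nonZero : ∀ k → ℕ.NonZero (den k)
  den-nonZero k = ℕ.m^n≢0 (1 ℕ.+ 2 ℕ.* k) 4

  1+n≤den : ∀ n → suc n ℕ.≤ den n
  1+n≤den n = begin
    suc n                      ≤⟨ ℕ.s≤s (ℕ.m≤n*m n 2) ⟩
    1 ℕ.+ 2 ℕ.* n              ≡⟨ ℕ.^-identityʳ (1 ℕ.+ 2 ℕ.* n) ⟨
    (1 ℕ.+ 2 ℕ.* n) ℕ.^ 1      ≤⟨ ℕ.^-monoʳ-≤ (1 ℕ.+ 2 ℕ.* n) {1} {4} (ℕ.s≤s ℕ.z≤n) ⟩
    den n                      ∎
    where open ℕ.≤-Reasoning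

  den-mono : ∀ k → den k ℕ.≤ den (suc k)
  den-mono k = ℕ.^-monoˡ-≤ 4 (ℕ.+-monoʳ-≤ 1 (ℕ.*-monoʳ-≤ 2 (ℕ.n≤1+n k)))

  1/den : ℕ → ℚ
  1/den k = (+ 1 / den k) {{den-nonZero k}}

  1/den-nonNeg : ∀ k → 0ℚ ≤ 1/den k
  1/den-nonNeg k = nonNegative⁻¹ (1/den k) {{normalize-nonNeg 1 (den k) {{den-nonZero k}}}}

  1/den-antitone : ∀ k → 1/den (suc k) ≤ 1/den k
  1/den-antitone k =
    1/-antimono (den k) (den (suc k)) {{den-nonZero k}} {{den-nonZero (suc k)}} (den-mono k)

  1/den-null : ∀ ε → 0ℚ < ε → ∃[ N ] (1/den N ≤ ε)
  1/den-null ε 0<ε with 1/-archimedean ε 0<ε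
  ... | N , 1/N≤ε = N ,
    ≤-trans (1/-antimono (suc N) (den N) {{_}} {{den-nonZero N}} (1+n≤den N)) 1/N≤ε

  β4-cauchy : IsCauchy (λ n → ∑< n β4-term)
  β4-cauchy = Alternating.S-cauchy 1/den 1/den-nonNeg 1/den-antitone 1/den-null

β4 : ℝ
β4 = mkℝ (λ n → ∑< n β4-term) β4-cauchy

β4-hasSum : HasSum β4-term β4
β4-hasSum = seq-limit β4

-- The shifted factorial (x)ₙ.
poch : ℚ → ℕ → ℚ
poch x zero    = 1ℚ
poch x (suc n) = poch x n * (x + fromℕ n)

H⁽²⁾ : ℕ → ℚ
H⁽²⁾ n = ∑< n (λ j → + 1 / suc j ℕ.^ 2)

3/2 : ℚ
3/2 = + 3 / 2

-8ℚ : ℚ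
-8ℚ = -[1+ 7 ] / 1

*-nonZero : ∀ p q .{{_ : NonZero p}} .{{q≢0 : NonZero q}} → NonZero (p * q)
*-nonZero p q = ≢-nonZero λ pq≡0 → 1≢0 (begin
  1ℚ                            ≡⟨ cong₂ _*_ (*-inverseˡ p) (*-inverseʳ q) ⟨
  (1/ p * p) * (q * 1/ q)       ≡⟨ regroup (1/ p) p q (1/ q) ⟩
  1/ p * (p * q) * 1/ q         ≡⟨ cong (λ z → 1/ p * z * 1/ q) pq≡0 ⟩
  1/ p * 0ℚ * 1/ q              ≡⟨ cong (_* 1/ q) (*-zeroʳ (1/ p)) ⟩
  0ℚ * 1/ q                     ≡⟨ *-zeroˡ (1/ q) ⟩
  0ℚ                            ∎)
  where
  open ≡-Reasoning
  open +-*-Solver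
  regroup : ∀ a b c d → (a * b) * (c * d) ≡ a * (b * c) * d
  regroup = solve 4 (λ a b c d → (a :* b) :* (c :* d) := a :* (b :* c) :* d) refl

^-nonZero : ∀ p n .{{_ : NonZero p}} → NonZero (p ^ n)
^-nonZero p zero    = _
^-nonZero p (suc n) = *-nonZero p (p ^ n) {{q≢0 = ^-nonZero p n}}

poch-pos : ∀ x n .{{_ : Positive x}} → Positive (poch x n)
poch-pos x zero    = _
poch-pos x (suc n) =
  pos*pos⇒pos (poch x n) {{poch-pos x n}} (x + fromℕ n)
    {{pos+nonNeg⇒pos x (fromℕ n) {{normalize-nonNeg n 1}}}}

summand : ℕ → ℚ
summand k =
  fromℕ (2 ℕ.+ 3 ℕ.* k) ÷ -8ℚ ^ k
    * (poch 1ℚ k ^ 3 ÷ poch 3/2 k ^ 3)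
    * (H⁽²⁾ (1 ℕ.+ 2 ℕ.* k) - (+ 5 / 4) * H⁽²⁾ k)
  where
  instance
    -8^k≢0 : NonZero (-8ℚ ^ k)
    -8^k≢0 = ^-nonZero -8ℚ k
    poch³≢0 : NonZero (poch 3/2 k ^ 3)
    poch³≢0 = ^-nonZero (poch 3/2 k) 3 {{pos⇒nonZero (poch 3/2 k) {{poch-pos 3/2 k}}}}

{-# OPTIONS --safe #-}

-- The theorem is the x² coefficient of the one-parameter identity
--   Σₙ t(n, x) = 2 Σⱼ (-1)ʲ / ((2j+1)² - x²),
--   t(n, x) = (3n+2) (-1/8)ⁿ n! (1+x)ₙ (1-x)ₙ / ((3/2)ₙ (3/2+x/2)ₙ (3/2-x/2)ₙ (1-x²)).
-- The partial fraction expansion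
--   t(n, x) = Σⱼ (-1)ʲ e(n, j) / ((2j+1)² - x²),
--   e(n, j) = (3n+2) n!/(8ⁿ (3/2)ₙ) (n+2j+1)! / ((2j-n)! (n-j)! (n+j+1)!)   for j ≤ n ≤ 2j,
-- has coefficients e(n, j) ≥ 0 with Σₙ e(n, j) = 2 for every j.  Taking the x² coefficient,
-- the N-th partial sum of the series is Σⱼ (-1)ʲ Eⱼ / (2j+1)⁴ with 0 ≤ Eⱼ ≤ 2, and Eⱼ = 2 as soon as 2j < N,
-- so it is within O(1/N) of the N-th partial sum of 2 β(4).  The two finite evaluations that
-- remain, in the direction of n and in the direction of j, are WZ telescopings.

module Submission where

open import Defs
import Data.Integer.Base as ℤ
import Data.Integer.Properties as ℤ
open import Data.List.Base using (List; []; _∷_)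
open import Data.List.Relation.Unary.All using (All; []; _∷_)
open import Data.Nat.Base as ℕ using (ℕ; zero; suc)
open import Data.Nat.Combinatorics using (_C_; nCk+nC[k+1]≡[n+1]C[k+1]; nC1≡n; k>n⇒nCk≡0)
import Data.Nat.Properties as ℕ
open import Data.Product.Base using (∃-syntax; _×_; _,_; proj₁; proj₂)
open import Data.Rational.Base
open import Data.Rational.Properties
open import Data.Rational.Solver using (module +-*-Solver)
import Data.Rational.Unnormalised.Base as ℚᵘ
import Data.Rational.Unnormalised.Properties as ℚᵘ
open import Data.Sum.Base using ([_,_]′)
open import Data.Vec.Base as Vec using (Vec; []; _∷_)
open import Relation.Binary.PropositionalEquality
  using (_≡_; refl; sym; trans; cong; cong₂; subst; subst₂; module ≡-Reasoning)

open +-*-Solver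

-- Embedding of the naturals in ℚ, and order facts.

fromℕ-+ : ∀ m n → fromℕ (m ℕ.+ n) ≡ fromℕ m + fromℕ n
fromℕ-+ m n = toℚᵘ-injective (begin
  toℚᵘ (fromℕ (m ℕ.+ n))                      ≈⟨ toℚᵘ-fromℚᵘ (ℤ.+ (m ℕ.+ n) ℚᵘ./ 1) ⟩
  ℤ.+ (m ℕ.+ n) ℚᵘ./ 1                        ≈⟨ ℚᵘ.*≡* (cong (ℤ._* ℤ.+ 1) (trans (ℤ.pos-+ m n) (sym (cong₂ ℤ._+_ (ℤ.*-identityʳ (ℤ.+ m)) (ℤ.*-identityʳ (ℤ.+ n)))))) ⟩
  (ℤ.+ m ℚᵘ./ 1) ℚᵘ.+ (ℤ.+ n ℚᵘ./ 1)          ≈⟨ ℚᵘ.+-cong (toℚᵘ-fromℚᵘ (ℤ.+ m ℚᵘ./ 1)) (toℚᵘ-fromℚᵘ (ℤ.+ n ℚᵘ./ 1)) ⟨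
  toℚᵘ (fromℕ m) ℚᵘ.+ toℚᵘ (fromℕ n)          ≈⟨ toℚᵘ-homo-+ (fromℕ m) (fromℕ n) ⟨
  toℚᵘ (fromℕ m + fromℕ n)                    ∎)
  where open ℚᵘ.≃-Reasoning

fromℕ-suc : ∀ n → fromℕ (suc n) ≡ 1ℚ + fromℕ n
fromℕ-suc = fromℕ-+ 1

fromℕ-* : ∀ m n → fromℕ (m ℕ.* n) ≡ fromℕ m * fromℕ n
fromℕ-* zero    n = sym (*-zeroˡ (fromℕ n))
fromℕ-* (suc m) n = begin
  fromℕ (n ℕ.+ m ℕ.* n)               ≡⟨ fromℕ-+ n (m ℕ.* n) ⟩
  fromℕ n + fromℕ (m ℕ.* n)           ≡⟨ cong (fromℕ n +_) (fromℕ-* m n) ⟩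
  fromℕ n + fromℕ m * fromℕ n         ≡⟨ solve 2 (λ m n → n :+ m :* n := (con 1ℚ :+ m) :* n) refl (fromℕ m) (fromℕ n) ⟩
  (1ℚ + fromℕ m) * fromℕ n            ≡⟨ cong (_* fromℕ n) (fromℕ-suc m) ⟨
  fromℕ (suc m) * fromℕ n             ∎
  where open ≡-Reasoning

0≤fromℕ : ∀ n → 0ℚ ≤ fromℕ n
0≤fromℕ n = nonNegative⁻¹ (fromℕ n) {{normalize-nonNeg n 1}}

*-reciprocal : ∀ d .{{_ : ℕ.NonZero d}} → fromℕ d * (ℤ.+ 1 / d) ≡ 1ℚ
*-reciprocal d@(suc _) = toℚᵘ-injective (begin
  toℚᵘ (fromℕ d * (ℤ.+ 1 / d))                 ≈⟨ toℚᵘ-homo-* (fromℕ d) (ℤ.+ 1 / d) ⟩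
  toℚᵘ (fromℕ d) ℚᵘ.* toℚᵘ (ℤ.+ 1 / d)         ≈⟨ ℚᵘ.*-cong (toℚᵘ-fromℚᵘ (ℤ.+ d ℚᵘ./ 1)) (toℚᵘ-fromℚᵘ (ℤ.+ 1 ℚᵘ./ d)) ⟩
  (ℤ.+ d ℚᵘ./ 1) ℚᵘ.* (ℤ.+ 1 ℚᵘ./ d)           ≈⟨ ℚᵘ.*≡* (trans (ℤ.*-identityʳ (ℤ.+ d ℤ.* ℤ.+ 1)) (trans (ℤ.*-identityʳ (ℤ.+ d)) (sym (trans (ℤ.*-identityˡ _) (ℤ.*-identityˡ _))))) ⟩
  toℚᵘ 1ℚ                                      ∎)
  where open ℚᵘ.≃-Reasoning

-- Serves to clear denominators: an identity is proved after multiplication by a positive factor,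
-- which is then cancelled.
*-cancelˡ-≡ : ∀ {p q c} → 0ℚ < c → c * p ≡ c * q → p ≡ q
*-cancelˡ-≡ {p} {q} {c} 0<c eq =
  ≤-antisym (*-cancelˡ-≤-pos c (≤-reflexive eq)) (*-cancelˡ-≤-pos c (≤-reflexive (sym eq)))
  where
  instance
    c-pos : Positive c
    c-pos = positive 0<c

0<1 : 0ℚ < 1ℚ
0<1 = positive⁻¹ 1ℚ

0<p+q : ∀ {p q} → 0ℚ < p → 0ℚ ≤ q → 0ℚ < p + q
0<p+q = +-mono-<-≤

0≤p+q : ∀ {p q} → 0ℚ ≤ p → 0ℚ ≤ q → 0ℚ ≤ p + q
0≤p+q = +-mono-≤

0<p*q : ∀ {p q} → 0ℚ < p → 0ℚ < q → 0ℚ < p * q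
0<p*q {p} {q} 0<p 0<q = positive⁻¹ (p * q) {{pos*pos⇒pos p {{positive 0<p}} q {{positive 0<q}}}}

0≤p*q : ∀ {p q} → 0ℚ ≤ p → 0ℚ ≤ q → 0ℚ ≤ p * q
0≤p*q {p} {q} 0≤p 0≤q =
  nonNegative⁻¹ (p * q) {{nonNeg*nonNeg⇒nonNeg p {{nonNegative 0≤p}} q {{nonNegative 0≤q}}}}

0<fromℕ-suc : ∀ n → 0ℚ < fromℕ (suc n)
0<fromℕ-suc n = positive⁻¹ (fromℕ (suc n)) {{normalize-pos (suc n) 1}}

κ : ∀ {n} → ℕ → Polynomial n
κ k = con (fromℕ k)

-- Linear combinations of equations

Equation : ℕ → Set
Equation n = Polynomial n × Polynomial n

Holds : ∀ {n} → Env n → Equation n → Set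
Holds ρ (l , r) = ⟦ l ⟧ ρ ≡ ⟦ r ⟧ ρ

combination : ∀ {n} → List (Polynomial n × Equation n) → Polynomial n
combination []                  = κ 0
combination ((c , l , r) ∷ ces) = c :* (l :- r) :+ combination ces

combination≡0 : ∀ {n} (ρ : Env n) ces → All (λ ce → Holds ρ (proj₂ ce)) ces → ⟦ combination ces ⟧ ρ ≡ 0ℚ
combination≡0 ρ []                  []         = refl
combination≡0 ρ ((c , l , r) ∷ ces) (l≡r ∷ eqs) = begin
  ⟦ c ⟧ ρ * (⟦ l ⟧ ρ - ⟦ r ⟧ ρ) + ⟦ combination ces ⟧ ρ
    ≡⟨ cong₂ (λ u v → ⟦ c ⟧ ρ * (u - ⟦ r ⟧ ρ) + v) l≡r (combination≡0 ρ ces eqs) ⟩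
  ⟦ c ⟧ ρ * (⟦ r ⟧ ρ - ⟦ r ⟧ ρ) + 0ℚ
    ≡⟨ solve 2 (λ c r → c :* (r :- r) :+ κ 0 := κ 0) refl (⟦ c ⟧ ρ) (⟦ r ⟧ ρ) ⟩
  0ℚ ∎
  where open ≡-Reasoning

-- If x - y is the combination Σ c (l - r), as polynomials, of equations l = r
-- that hold at ρ, then x = y holds at ρ.
linear-combination :
  ∀ n (f : Vec (Polynomial n) n → Equation n × List (Polynomial n × Equation n)) (ρ : Env n) →
  let vars = Vec.map var (Vec.allFin n)
      x    = proj₁ (proj₁ (f vars))
      y    = proj₂ (proj₁ (f vars))
      ces  = proj₂ (f vars)
  in normalise (x :- y) ≡ normalise (combination ces) →
     All (λ ce → Holds ρ (proj₂ ce)) ces →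
     ⟦ x ⟧ ρ ≡ ⟦ y ⟧ ρ
linear-combination n f ρ nf≡ eqs = begin
  X                 ≡⟨ solve 2 (λ x y → x := (x :- y) :+ y) refl X Y ⟩
  (X - Y) + Y       ≡⟨ cong (_+ Y) (prove ρ (x :- y) (combination ces) (cong (λ p → ⟦ p ⟧N ρ) nf≡)) ⟩
  ⟦ combination ces ⟧ ρ + Y  ≡⟨ cong (_+ Y) (combination≡0 ρ ces eqs) ⟩
  0ℚ + Y            ≡⟨ +-identityˡ Y ⟩
  Y                 ∎
  where
  open ≡-Reasoning
  vars = Vec.map var (Vec.allFin n)
  x   = proj₁ (proj₁ (f vars))
  y   = proj₂ (proj₁ (f vars))
  ces = proj₂ (f vars)
  X = ⟦ x ⟧ ρ
  Y = ⟦ y ⟧ ρ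

-- Binomial coefficients

binom : ℕ → ℕ → ℚ
binom n k = fromℕ (n C k)

0≤binom : ∀ n k → 0ℚ ≤ binom n k
0≤binom n k = 0≤fromℕ (n C k)

pascal : ∀ n k → binom (suc n) (suc k) ≡ binom n k + binom n (suc k)
pascal n k = trans (cong fromℕ (sym (nCk+nC[k+1]≡[n+1]C[k+1] n k))) (fromℕ-+ (n C k) (n C suc k))

binom-zero : ∀ n → binom n 0 ≡ 1ℚ
binom-zero zero    = refl
binom-zero (suc n) = refl

binom-absorb : ∀ n k → (1ℚ + fromℕ k) * binom (suc n) (suc k) ≡ (1ℚ + fromℕ n) * binom n k
binom-absorb n zero = begin
  (1ℚ + 0ℚ) * binom (suc n) 1    ≡⟨ *-identityˡ (binom (suc n) 1) ⟩
  binom (suc n) 1                ≡⟨ cong fromℕ (nC1≡n (suc n)) ⟩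
  fromℕ (suc n)                  ≡⟨ fromℕ-suc n ⟩
  1ℚ + fromℕ n                   ≡⟨ *-identityʳ (1ℚ + fromℕ n) ⟨
  (1ℚ + fromℕ n) * 1ℚ            ≡⟨ cong ((1ℚ + fromℕ n) *_) (binom-zero n) ⟨
  (1ℚ + fromℕ n) * binom n 0     ∎
  where open ≡-Reasoning
binom-absorb zero    (suc k) = *-zeroʳ (1ℚ + fromℕ (suc k))
binom-absorb (suc n) (suc k) = begin
  (1ℚ + fromℕ (suc k)) * binom (suc (suc n)) (suc (suc k))
    ≡⟨ cong₂ (λ x y → (1ℚ + x) * y) (fromℕ-suc k) (pascal (suc n) (suc k)) ⟩
  (1ℚ + (1ℚ + K)) * (b + c)
    ≡⟨ solve 3 (λ k b c → (κ 1 :+ (κ 1 :+ k)) :* (b :+ c) := b :+ (κ 1 :+ k) :* b :+ (κ 1 :+ (κ 1 :+ k)) :* c) refl K b c ⟩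
  b + (1ℚ + K) * b + (1ℚ + (1ℚ + K)) * c
    ≡⟨ cong₂ (λ x y → b + x + y) (binom-absorb n k)
         (trans (cong (λ z → (1ℚ + z) * c) (sym (fromℕ-suc k))) (binom-absorb n (suc k))) ⟩
  b + (1ℚ + N) * binom n k + (1ℚ + N) * binom n (suc k)
    ≡⟨ solve 4 (λ n b d e → b :+ (κ 1 :+ n) :* d :+ (κ 1 :+ n) :* e := b :+ (κ 1 :+ n) :* (d :+ e)) refl N b (binom n k) (binom n (suc k)) ⟩
  b + (1ℚ + N) * (binom n k + binom n (suc k))
    ≡⟨ cong (λ z → b + (1ℚ + N) * z) (pascal n k) ⟨
  b + (1ℚ + N) * b
    ≡⟨ solve 2 (λ n b → b :+ (κ 1 :+ n) :* b := (κ 1 :+ (κ 1 :+ n)) :* b) refl N b ⟩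
  (1ℚ + (1ℚ + N)) * b
    ≡⟨ cong (λ z → (1ℚ + z) * b) (fromℕ-suc n) ⟨
  (1ℚ + fromℕ (suc n)) * b ∎
  where
  open ≡-Reasoning
  N K b c : ℚ
  N = fromℕ n
  K = fromℕ k
  b = binom (suc n) (suc k)
  c = binom (suc n) (suc (suc k))

-- Absorption minus k + 1 times Pascal's rule. The subtraction is in ℚ, so k ≥ n is covered as well:
-- both sides are then zero.
binom-lower : ∀ n k → (1ℚ + fromℕ k) * binom n (suc k) ≡ (fromℕ n - fromℕ k) * binom n k
binom-lower n k = linear-combination 5
  (λ { (N ∷ K ∷ b₀₀ ∷ b₀₁ ∷ b₁₁ ∷ []) →
    ((κ 1 :+ K) :* b₀₁ := (N :- K) :* b₀₀) ,
    (κ 1 , ((κ 1 :+ K) :* b₁₁ := (κ 1 :+ N) :* b₀₀)) ∷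
    (:- (κ 1 :+ K) , (b₁₁ := b₀₀ :+ b₀₁)) ∷ [] })
  (fromℕ n ∷ fromℕ k ∷ binom n k ∷ binom n (suc k) ∷ binom (suc n) (suc k) ∷ []) refl
  (binom-absorb n k ∷ pascal n k ∷ [])

binom-upper : ∀ n k → (1ℚ + fromℕ n - fromℕ k) * binom (suc n) k ≡ (1ℚ + fromℕ n) * binom n k
binom-upper n k = begin
  (1ℚ + fromℕ n - fromℕ k) * binom (suc n) k       ≡⟨ cong (λ z → (z - fromℕ k) * binom (suc n) k) (fromℕ-suc n) ⟨
  (fromℕ (suc n) - fromℕ k) * binom (suc n) k      ≡⟨ binom-lower (suc n) k ⟨
  (1ℚ + fromℕ k) * binom (suc n) (suc k)           ≡⟨ binom-absorb n k ⟩
  (1ℚ + fromℕ n) * binom n k                       ∎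
  where open ≡-Reasoning

-- The equations for `N` and `K` allow linear forms in `fromℕ i` and `fromℕ j` to appear in the
-- result directly.
binom-absorb′ : ∀ n k {N K} → fromℕ n ≡ N → fromℕ k ≡ K → (1ℚ + K) * binom (suc n) (suc k) ≡ (1ℚ + N) * binom n k
binom-absorb′ n k refl refl = binom-absorb n k

binom-lower′ : ∀ n k {N K} → fromℕ n ≡ N → fromℕ k ≡ K → (1ℚ + K) * binom n (suc k) ≡ (N - K) * binom n k
binom-lower′ n k refl refl = binom-lower n k

binom-upper′ : ∀ n k {N K} → fromℕ n ≡ N → fromℕ k ≡ K → (1ℚ + N - K) * binom (suc n) k ≡ (1ℚ + N) * binom n k
binom-upper′ n k refl refl = binom-upper n k

-- With n = i + j this is the multinomial coefficient (n+2j+1)! / ((2j-n)! (n-j)! (n+j+1)!).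
mult : ℕ → ℕ → ℚ
mult i j = binom (suc (j ℕ.* 3 ℕ.+ i)) j * binom j i

-- Contiguous relations and the two WZ certificates.

module Shifts (i j : ℕ) where

  I J : ℚ
  I = fromℕ i
  J = fromℕ j

  -- With `j * 3` instead of `3 * j`, replacing `j` by `suc j` adds 3 by computation, so
  -- `mult i (suc j)` is `A₄ * B₁₀` definitionally. Shifts in `i` need `mult-suc` and
  -- `mult-suc-suc`.
  t : ℕ
  t = j ℕ.* 3 ℕ.+ i

  A₁ A₂ A₃ A₄ A₅ A₆ : ℚ
  A₁ = binom (1 ℕ.+ t) j
  A₂ = binom (2 ℕ.+ t) j
  A₃ = binom (3 ℕ.+ t) j
  A₄ = binom (4 ℕ.+ t) (suc j)
  A₅ = binom (5 ℕ.+ t) (suc j)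
  A₆ = binom (6 ℕ.+ t) (suc (suc j))

  B₀₀ B₀₁ B₁₀ B₁₁ : ℚ
  B₀₀ = binom j i
  B₀₁ = binom j (suc i)
  B₁₀ = binom (suc j) i
  B₁₁ = binom (suc j) (suc i)

  mult-suc : mult (suc i) j ≡ A₂ * B₀₁
  mult-suc = cong (λ n → binom (suc n) j * B₀₁) (ℕ.+-suc (j ℕ.* 3) i)

  mult-suc-suc : mult (suc i) (suc j) ≡ A₅ * B₁₁
  mult-suc-suc = cong (λ n → binom (4 ℕ.+ n) (suc j) * B₁₁) (ℕ.+-suc (j ℕ.* 3) i)

  fromℕ-t : ∀ k → fromℕ (k ℕ.+ t) ≡ fromℕ k + fromℕ 3 * J + I
  fromℕ-t k = begin
    fromℕ (k ℕ.+ t)                          ≡⟨ fromℕ-+ k t ⟩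
    fromℕ k + fromℕ t                        ≡⟨ cong (fromℕ k +_) (fromℕ-+ (j ℕ.* 3) i) ⟩
    fromℕ k + (fromℕ (j ℕ.* 3) + I)          ≡⟨ cong (λ z → fromℕ k + (z + I)) (fromℕ-* j 3) ⟩
    fromℕ k + (J * fromℕ 3 + I)              ≡⟨ solve 3 (λ k j i → k :+ (j :* κ 3 :+ i) := k :+ κ 3 :* j :+ i) refl (fromℕ k) J I ⟩
    fromℕ k + fromℕ 3 * J + I                ∎
    where open ≡-Reasoning

  -- Consecutive members of the chain A₁, ..., A₆ are linked by one first-order relation each; with
  -- those for the B's, they make both certificates linear combinations of known equations.
  A₁-A₂ : (1ℚ + (1ℚ + fromℕ 3 * J + I) - J) * A₂ ≡ (1ℚ + (1ℚ + fromℕ 3 * J + I)) * A₁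
  A₁-A₂ = binom-upper′ (1 ℕ.+ t) j (fromℕ-t 1) refl

  A₂-A₃ : (1ℚ + (fromℕ 2 + fromℕ 3 * J + I) - J) * A₃ ≡ (1ℚ + (fromℕ 2 + fromℕ 3 * J + I)) * A₂
  A₂-A₃ = binom-upper′ (2 ℕ.+ t) j (fromℕ-t 2) refl

  A₃-A₄ : (1ℚ + J) * A₄ ≡ (1ℚ + (fromℕ 3 + fromℕ 3 * J + I)) * A₃
  A₃-A₄ = binom-absorb′ (3 ℕ.+ t) j (fromℕ-t 3) refl

  A₄-A₅ : (1ℚ + (fromℕ 4 + fromℕ 3 * J + I) - (1ℚ + J)) * A₅ ≡ (1ℚ + (fromℕ 4 + fromℕ 3 * J + I)) * A₄
  A₄-A₅ = binom-upper′ (4 ℕ.+ t) (suc j) (fromℕ-t 4) (fromℕ-suc j)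

  A₅-A₆ : (1ℚ + (1ℚ + J)) * A₆ ≡ (1ℚ + (fromℕ 5 + fromℕ 3 * J + I)) * A₅
  A₅-A₆ = binom-absorb′ (5 ℕ.+ t) (suc j) (fromℕ-t 5) (fromℕ-suc j)

  B₀₀-B₀₁ : (1ℚ + I) * B₀₁ ≡ (J - I) * B₀₀
  B₀₀-B₀₁ = binom-lower j i

  B₁₀-B₁₁ : (1ℚ + I) * B₁₁ ≡ ((1ℚ + J) - I) * B₁₀
  B₁₀-B₁₁ = binom-lower′ (suc j) i (fromℕ-suc j) refl

  B₀₁-B₁₁ : (1ℚ + J - (1ℚ + I)) * B₁₁ ≡ (1ℚ + J) * B₀₁
  B₀₁-B₁₁ = binom-upper′ j (suc i) refl (fromℕ-suc i)

  0≤I : 0ℚ ≤ I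
  0≤I = 0≤fromℕ i

  0≤J : 0ℚ ≤ J
  0≤J = 0≤fromℕ j

  0<1+I : 0ℚ < 1ℚ + I
  0<1+I = 0<p+q 0<1 0≤I

  0<1+J : 0ℚ < 1ℚ + J
  0<1+J = 0<p+q 0<1 0≤J

  0<k+2J+I : ∀ k → 0ℚ < fromℕ (suc k) + fromℕ 2 * J + I
  0<k+2J+I k = 0<p+q (0<p+q (0<fromℕ-suc k) (0≤p*q (0≤fromℕ 2) 0≤J)) 0≤I

  -- At n = i + j + 1 this is e(n, j + 1) - e(n, j) = G(n, j) - G(n + 1, j), with G given by
  -- `boundary`; `a` and `a′` stand for the amplitudes at n and n + 1, which enter only through
  -- their recurrence.
  wz₁ : ∀ {a a′} → let N = 1ℚ + J + I in
        fromℕ 4 * (fromℕ 2 * N + fromℕ 3) * a′ ≡ (1ℚ + N) * a →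
        (fromℕ 3 * N + fromℕ 2) * a * (A₄ * B₁₀) - (fromℕ 3 * N + fromℕ 2) * a * (A₂ * B₀₁)
        ≡ fromℕ 8 * (fromℕ 2 * N + 1ℚ) * a * (A₂ * B₁₀) - fromℕ 8 * (fromℕ 2 * N + fromℕ 3) * a′ * (A₃ * B₁₁)
  wz₁ {a} {a′} a′-a = *-cancelˡ-≡ (0<p*q (0<p*q 0<1+J 0<1+I) (0<k+2J+I 2))
    (linear-combination 10
      (λ { (J ∷ I ∷ A₂ ∷ A₃ ∷ A₄ ∷ B₁₀ ∷ B₁₁ ∷ B₀₁ ∷ a ∷ a′ ∷ []) →
        let N = κ 1 :+ J :+ I
            T = κ 3 :* J :+ I
            C = κ 3 :+ κ 2 :* J :+ I
            -- The product of the leading factors of `A₃-A₄`, `B₁₀-B₁₁` and `A₂-A₃`.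
            Δ = (κ 1 :+ J) :* (κ 1 :+ I) :* C
            M = κ 3 :* N :+ κ 2
        in (Δ :* (M :* a :* (A₄ :* B₁₀) :- M :* a :* (A₂ :* B₀₁)) :=
            Δ :* (κ 8 :* (κ 2 :* N :+ κ 1) :* a :* (A₂ :* B₁₀) :- κ 8 :* (κ 2 :* N :+ κ 3) :* a′ :* (A₃ :* B₁₁))) ,
           (M :* a :* B₁₀ :* (κ 1 :+ I) :* C ,
             ((κ 1 :+ J) :* A₄ := (κ 1 :+ (κ 3 :+ κ 3 :* J :+ I)) :* A₃)) ∷
           ((T :+ κ 4) :* M :* a :* B₁₀ :* (κ 1 :+ I) :+ κ 2 :* (κ 1 :+ J) :* (κ 1 :+ I) :* (κ 1 :+ N) :* a :* B₁₁ ,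
             ((κ 1 :+ (κ 2 :+ κ 3 :* J :+ I) :- J) :* A₃ := (κ 1 :+ (κ 2 :+ κ 3 :* J :+ I)) :* A₂)) ∷
           ((κ 1 :+ I) :* C :* M :* a :* A₂ ,
             ((κ 1 :+ J :- (κ 1 :+ I)) :* B₁₁ := (κ 1 :+ J) :* B₀₁)) ∷
           (κ 2 :* (κ 1 :+ J) :* (κ 1 :+ N) :* a :* (T :+ κ 3) :* A₂ :- C :* M :* a :* A₂ :* (J :- I) ,
             ((κ 1 :+ I) :* B₁₁ := ((κ 1 :+ J) :- I) :* B₁₀)) ∷
           (κ 2 :* Δ :* A₃ :* B₁₁ ,
             (κ 4 :* (κ 2 :* N :+ κ 3) :* a′ := (κ 1 :+ N) :* a)) ∷ [] })
      (J ∷ I ∷ A₂ ∷ A₃ ∷ A₄ ∷ B₁₀ ∷ B₁₁ ∷ B₀₁ ∷ a ∷ a′ ∷ []) refl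
      (A₃-A₄ ∷ A₂-A₃ ∷ B₀₁-B₁₁ ∷ B₁₀-B₁₁ ∷ a′-a ∷ []))

  -- The telescoping in j for `kernel`, with u = 1/(2j + 3)². Signs alternate in j, so the
  -- difference of two values of `antidifference` appears as a sum.
  wz₂ : ∀ {u} → let N = 1ℚ + J + I in
        (fromℕ 2 * (1ℚ + J) + 1ℚ) * (fromℕ 2 * (1ℚ + J) + 1ℚ) * u ≡ 1ℚ →
        (1ℚ + N) * (fromℕ 2 * N + fromℕ 3) *
          (u * ((fromℕ 2 * N + fromℕ 3) * (fromℕ 2 * N + fromℕ 3) * (A₅ * B₁₁) + fromℕ 4 * ((1ℚ + N) * (1ℚ + N)) * (A₄ * B₁₀)))
        ≡ (fromℕ 3 * N + fromℕ 4) * ((1ℚ + (1ℚ + J)) * (A₆ * B₁₀) + (1ℚ + J) * (A₄ * B₀₁))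
  wz₂ {u} u-eq = *-cancelˡ-≡ (0<p*q (0<k+2J+I 3) 0<1+I)
    (linear-combination 9
      (λ { (J ∷ I ∷ A₄ ∷ A₅ ∷ A₆ ∷ B₁₀ ∷ B₁₁ ∷ B₀₁ ∷ u ∷ []) →
        let N = κ 1 :+ J :+ I
            T = κ 3 :* J :+ I
            C = κ 4 :+ κ 2 :* J :+ I
            Δ = C :* (κ 1 :+ I)
            S = (κ 2 :* N :+ κ 3) :* (κ 2 :* N :+ κ 3)
            K = (κ 1 :+ N) :* (κ 2 :* N :+ κ 3)
            M = κ 3 :* N :+ κ 4
        in (Δ :* (K :* (u :* (S :* (A₅ :* B₁₁) :+ κ 4 :* ((κ 1 :+ N) :* (κ 1 :+ N)) :* (A₄ :* B₁₀)))) :=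
            Δ :* (M :* ((κ 1 :+ (κ 1 :+ J)) :* (A₆ :* B₁₀) :+ (κ 1 :+ J) :* (A₄ :* B₀₁)))) ,
           (K :* u :* S :* (κ 1 :+ I) :* B₁₁ :- (κ 1 :+ I) :* M :* (T :+ κ 6) :* B₁₀ ,
             ((κ 1 :+ (κ 4 :+ κ 3 :* J :+ I) :- (κ 1 :+ J)) :* A₅ := (κ 1 :+ (κ 4 :+ κ 3 :* J :+ I)) :* A₄)) ∷
           (:- Δ :* M :* B₁₀ ,
             ((κ 1 :+ (κ 1 :+ J)) :* A₆ := (κ 1 :+ (κ 5 :+ κ 3 :* J :+ I)) :* A₅)) ∷
           (Δ :* M :* A₄ ,
             ((κ 1 :+ J :- (κ 1 :+ I)) :* B₁₁ := (κ 1 :+ J) :* B₀₁)) ∷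
           (K :* u :* S :* (T :+ κ 5) :* A₄ :- C :* M :* A₄ :* (J :- I) ,
             ((κ 1 :+ I) :* B₁₁ := ((κ 1 :+ J) :- I) :* B₁₀)) ∷
           -- Once everything is expressed by A₄ and B₁₀, the bracket multiplied by u is divisible
           -- by (2j + 3)², so the reciprocal disappears.
           (K :* A₄ :* B₁₀ :* (N :+ κ 2) :* M ,
             ((κ 2 :* (κ 1 :+ J) :+ κ 1) :* (κ 2 :* (κ 1 :+ J) :+ κ 1) :* u := κ 1)) ∷ [] })
      (J ∷ I ∷ A₄ ∷ A₅ ∷ A₆ ∷ B₁₀ ∷ B₁₁ ∷ B₀₁ ∷ u ∷ []) refl
      (A₄-A₅ ∷ A₅-A₆ ∷ B₀₁-B₁₁ ∷ B₁₀-B₁₁ ∷ u-eq ∷ []))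

  mult-step : (1ℚ + I) * (fromℕ 2 + fromℕ 2 * J + I) * mult (suc i) j ≡ (J - I) * (fromℕ 2 + fromℕ 3 * J + I) * mult i j
  mult-step = linear-combination 7
    (λ { (J ∷ I ∷ A₁ ∷ A₂ ∷ B₀₀ ∷ B₀₁ ∷ m ∷ []) →
      let C = κ 2 :+ κ 2 :* J :+ I in
      ((κ 1 :+ I) :* C :* m := (J :- I) :* (κ 2 :+ κ 3 :* J :+ I) :* (A₁ :* B₀₀)) ,
      ((κ 1 :+ I) :* C , (m := A₂ :* B₀₁)) ∷
      ((κ 1 :+ I) :* B₀₁ , ((κ 1 :+ (κ 1 :+ κ 3 :* J :+ I) :- J) :* A₂ := (κ 1 :+ (κ 1 :+ κ 3 :* J :+ I)) :* A₁)) ∷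
      ((κ 2 :+ κ 3 :* J :+ I) :* A₁ , ((κ 1 :+ I) :* B₀₁ := (J :- I) :* B₀₀)) ∷ [] })
    (J ∷ I ∷ A₁ ∷ A₂ ∷ B₀₀ ∷ B₀₁ ∷ mult (suc i) j ∷ []) refl
    (mult-suc ∷ A₁-A₂ ∷ B₀₀-B₀₁ ∷ [])

-- The factor n!/(8ⁿ (3/2)ₙ) and its recurrence.

reciprocal-sq : ∀ d .{{_ : ℕ.NonZero (d ℕ.^ 2)}} → fromℕ d * fromℕ d * (ℤ.+ 1 / d ℕ.^ 2) ≡ 1ℚ
reciprocal-sq d = begin
  fromℕ d * fromℕ d * (ℤ.+ 1 / d ℕ.^ 2)       ≡⟨ cong (_* (ℤ.+ 1 / d ℕ.^ 2)) (fromℕ-* d d) ⟨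
  fromℕ (d ℕ.* d) * (ℤ.+ 1 / d ℕ.^ 2)         ≡⟨ cong (λ n → fromℕ (d ℕ.* n) * (ℤ.+ 1 / d ℕ.^ 2)) (ℕ.*-identityʳ d) ⟨
  fromℕ (d ℕ.^ 2) * (ℤ.+ 1 / d ℕ.^ 2)         ≡⟨ *-reciprocal (d ℕ.^ 2) ⟩
  1ℚ ∎
  where open ≡-Reasoning

-- This is n!/(3/2)ₙ, built by its recurrence to avoid quotients of shifted factorials; `ratio-poch`
-- identifies it.
ratio : ℕ → ℚ
ratio zero    = 1ℚ
ratio (suc n) = ratio n * (fromℕ 2 * (1ℚ + fromℕ n)) * (ℤ.+ 1 / (3 ℕ.+ 2 ℕ.* n))

fromℕ-odd : ∀ k n → fromℕ (k ℕ.+ 2 ℕ.* n) ≡ fromℕ 2 * fromℕ n + fromℕ k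
fromℕ-odd k n = begin
  fromℕ (k ℕ.+ 2 ℕ.* n)         ≡⟨ fromℕ-+ k (2 ℕ.* n) ⟩
  fromℕ k + fromℕ (2 ℕ.* n)     ≡⟨ cong (fromℕ k +_) (fromℕ-* 2 n) ⟩
  fromℕ k + fromℕ 2 * fromℕ n   ≡⟨ +-comm (fromℕ k) (fromℕ 2 * fromℕ n) ⟩
  fromℕ 2 * fromℕ n + fromℕ k   ∎
  where open ≡-Reasoning

reciprocal-odd : ∀ n → (fromℕ 2 * fromℕ n + fromℕ 3) * (ℤ.+ 1 / (3 ℕ.+ 2 ℕ.* n)) ≡ 1ℚ
reciprocal-odd n =
  trans (cong (_* (ℤ.+ 1 / (3 ℕ.+ 2 ℕ.* n))) (sym (fromℕ-odd 3 n))) (*-reciprocal (3 ℕ.+ 2 ℕ.* n))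

ratio-suc : ∀ n → (fromℕ 2 * fromℕ n + fromℕ 3) * ratio (suc n) ≡ fromℕ 2 * (1ℚ + fromℕ n) * ratio n
ratio-suc n = linear-combination 3
  (λ { (N ∷ r ∷ v ∷ []) →
    ((κ 2 :* N :+ κ 3) :* (r :* (κ 2 :* (κ 1 :+ N)) :* v) := κ 2 :* (κ 1 :+ N) :* r) ,
    (κ 2 :* (κ 1 :+ N) :* r , ((κ 2 :* N :+ κ 3) :* v := κ 1)) ∷ [] })
  (fromℕ n ∷ ratio n ∷ (ℤ.+ 1 / (3 ℕ.+ 2 ℕ.* n)) ∷ []) refl (reciprocal-odd n ∷ [])

⅛ : ℚ
⅛ = ℤ.+ 1 / 8

amplitude : ℕ → ℚ
amplitude n = ratio n * ⅛ ^ n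

amplitude-suc : ∀ n → fromℕ 4 * (fromℕ 2 * fromℕ n + fromℕ 3) * amplitude (suc n) ≡ (1ℚ + fromℕ n) * amplitude n
amplitude-suc n = linear-combination 4
  (λ { (N ∷ r ∷ r′ ∷ e ∷ []) →
    (κ 4 :* (κ 2 :* N :+ κ 3) :* (r′ :* (con ⅛ :* e)) := (κ 1 :+ N) :* (r :* e)) ,
    (con ½ :* e , ((κ 2 :* N :+ κ 3) :* r′ := κ 2 :* (κ 1 :+ N) :* r)) ∷ [] })
  (fromℕ n ∷ ratio n ∷ ratio (suc n) ∷ ⅛ ^ n ∷ []) refl (ratio-suc n ∷ [])

0<3+2n : ∀ n → 0ℚ < fromℕ 2 * fromℕ n + fromℕ 3
0<3+2n n = subst (0ℚ <_) (fromℕ-odd 3 n) (0<fromℕ-suc (2 ℕ.+ 2 ℕ.* n))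

0≤amplitude : ∀ n → 0ℚ ≤ amplitude n
0≤amplitude n = 0≤p*q (0≤ratio n) (0≤⅛^ n)
  where
  0≤ratio : ∀ n → 0ℚ ≤ ratio n
  0≤ratio zero    = nonNegative⁻¹ 1ℚ
  0≤ratio (suc n) = 0≤p*q (0≤p*q (0≤ratio n) (0≤p*q (0≤fromℕ 2) (0≤p+q (0≤fromℕ 1) (0≤fromℕ n))))
    (nonNegative⁻¹ _ {{normalize-nonNeg 1 (3 ℕ.+ 2 ℕ.* n)}})
  0≤⅛^ : ∀ n → 0ℚ ≤ ⅛ ^ n
  0≤⅛^ zero    = nonNegative⁻¹ 1ℚ
  0≤⅛^ (suc n) = 0≤p*q (nonNegative⁻¹ ⅛) (0≤⅛^ n)

-- Summation over n

coeff : ℕ → ℚ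
coeff n = (fromℕ 3 * fromℕ n + fromℕ 2) * amplitude n

-- term i j = e(i + j, j).
term : ℕ → ℕ → ℚ
term i j = coeff (j ℕ.+ i) * mult i j

column : ℕ → ℕ → ℚ
column k j = ∑< k (λ i → term i j)

-- The WZ mate G(n, j) of e(n, j), at n = i + j + 1: the common n of `term i (suc j)` and
-- `term (suc i) j`.
boundary : ℕ → ℕ → ℚ
boundary i j = fromℕ 8 * (fromℕ 2 * fromℕ n + 1ℚ) * amplitude n * (binom (2 ℕ.+ (j ℕ.* 3 ℕ.+ i)) j * binom (suc j) i)
  where
  n : ℕ
  n = suc (j ℕ.+ i)

0≤term : ∀ i j → 0ℚ ≤ term i j
0≤term i j = 0≤p*q
  (0≤p*q (0≤p+q (0≤p*q (0≤fromℕ 3) (0≤fromℕ (j ℕ.+ i))) (0≤fromℕ 2)) (0≤amplitude (j ℕ.+ i)))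
  (0≤p*q (0≤binom (suc (j ℕ.* 3 ℕ.+ i)) j) (0≤binom j i))

0≤boundary : ∀ i j → 0ℚ ≤ boundary i j
0≤boundary i j = 0≤p*q
  (0≤p*q (0≤p*q (0≤fromℕ 8) (0≤p+q (0≤p*q (0≤fromℕ 2) (0≤fromℕ n)) (0≤fromℕ 1))) (0≤amplitude n))
  (0≤p*q (0≤binom (2 ℕ.+ (j ℕ.* 3 ℕ.+ i)) j) (0≤binom (suc j) i))
  where
  n : ℕ
  n = suc (j ℕ.+ i)

binom-vanish : ∀ {n k} → n ℕ.< k → binom n k ≡ 0ℚ
binom-vanish n<k = cong fromℕ (k>n⇒nCk≡0 n<k)

boundary-vanish : ∀ {i j} → suc j ℕ.< i → boundary i j ≡ 0ℚ
boundary-vanish {i} {j} 1+j<i = begin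
  c * (b * binom (suc j) i)  ≡⟨ cong (λ z → c * (b * z)) (binom-vanish 1+j<i) ⟩
  c * (b * 0ℚ)               ≡⟨ solve 2 (λ c b → c :* (b :* κ 0) := κ 0) refl c b ⟩
  0ℚ                         ∎
  where
  open ≡-Reasoning
  b c : ℚ
  b = binom (2 ℕ.+ (j ℕ.* 3 ℕ.+ i)) j
  c = fromℕ 8 * (fromℕ 2 * fromℕ (suc (j ℕ.+ i)) + 1ℚ) * amplitude (suc (j ℕ.+ i))

fromℕ-1+j+i : ∀ i j → fromℕ (suc (j ℕ.+ i)) ≡ 1ℚ + fromℕ j + fromℕ i
fromℕ-1+j+i i j = begin
  fromℕ (suc (j ℕ.+ i))         ≡⟨ fromℕ-suc (j ℕ.+ i) ⟩
  1ℚ + fromℕ (j ℕ.+ i)          ≡⟨ cong (1ℚ +_) (fromℕ-+ j i) ⟩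
  1ℚ + (fromℕ j + fromℕ i)      ≡⟨ +-assoc 1ℚ (fromℕ j) (fromℕ i) ⟨
  1ℚ + fromℕ j + fromℕ i        ∎
  where open ≡-Reasoning

module _ (i j : ℕ) where
  open Shifts i j

  private
    n : ℕ
    n = suc (j ℕ.+ i)

    N : ℚ
    N = 1ℚ + J + I

    fromℕ-n : fromℕ n ≡ N
    fromℕ-n = fromℕ-1+j+i i j

    term-suc : term (suc i) j ≡ (fromℕ 3 * N + fromℕ 2) * amplitude n * (A₂ * B₀₁)
    term-suc = begin
      coeff (j ℕ.+ suc i) * mult (suc i) j                     ≡⟨ cong₂ (λ n m → coeff n * m) (ℕ.+-suc j i) mult-suc ⟩
      coeff n * (A₂ * B₀₁)                                     ≡⟨ cong (λ N → (fromℕ 3 * N + fromℕ 2) * amplitude n * (A₂ * B₀₁)) fromℕ-n ⟩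
      (fromℕ 3 * N + fromℕ 2) * amplitude n * (A₂ * B₀₁)       ∎
      where open ≡-Reasoning

    boundary-suc : boundary (suc i) j ≡ fromℕ 8 * (fromℕ 2 * N + fromℕ 3) * amplitude (suc n) * (A₃ * B₁₁)
    boundary-suc = begin
      boundary (suc i) j
        ≡⟨ cong₂ (λ n t → fromℕ 8 * (fromℕ 2 * fromℕ (suc n) + 1ℚ) * amplitude (suc n) * (binom (2 ℕ.+ t) j * B₁₁))
             (ℕ.+-suc j i) (ℕ.+-suc (j ℕ.* 3) i) ⟩
      fromℕ 8 * (fromℕ 2 * fromℕ (suc n) + 1ℚ) * a * (A₃ * B₁₁)
        ≡⟨ cong (λ z → fromℕ 8 * (fromℕ 2 * z + 1ℚ) * a * (A₃ * B₁₁)) (trans (fromℕ-suc n) (cong (1ℚ +_) fromℕ-n)) ⟩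
      fromℕ 8 * (fromℕ 2 * (1ℚ + N) + 1ℚ) * a * (A₃ * B₁₁)
        ≡⟨ cong (λ z → fromℕ 8 * z * a * (A₃ * B₁₁)) (solve 1 (λ n → κ 2 :* (κ 1 :+ n) :+ κ 1 := κ 2 :* n :+ κ 3) refl N) ⟩
      fromℕ 8 * (fromℕ 2 * N + fromℕ 3) * a * (A₃ * B₁₁) ∎
      where
      open ≡-Reasoning
      a : ℚ
      a = amplitude (suc n)

  term-shift : term i (suc j) - term (suc i) j ≡ boundary i j - boundary (suc i) j
  term-shift = begin
    term i (suc j) - term (suc i) j
      ≡⟨ cong₂ _-_ (cong (λ N → (fromℕ 3 * N + fromℕ 2) * amplitude n * (A₄ * B₁₀)) fromℕ-n) term-suc ⟩
    (fromℕ 3 * N + fromℕ 2) * amplitude n * (A₄ * B₁₀) - (fromℕ 3 * N + fromℕ 2) * amplitude n * (A₂ * B₀₁)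
      ≡⟨ wz₁ (subst (λ N → fromℕ 4 * (fromℕ 2 * N + fromℕ 3) * amplitude (suc n) ≡ (1ℚ + N) * amplitude n) fromℕ-n (amplitude-suc n)) ⟩
    fromℕ 8 * (fromℕ 2 * N + 1ℚ) * amplitude n * (A₂ * B₁₀) - fromℕ 8 * (fromℕ 2 * N + fromℕ 3) * amplitude (suc n) * (A₃ * B₁₁)
      ≡⟨ cong₂ _-_ (cong (λ N → fromℕ 8 * (fromℕ 2 * N + 1ℚ) * amplitude n * (A₂ * B₁₀)) fromℕ-n) boundary-suc ⟨
    boundary i j - boundary (suc i) j ∎
    where open ≡-Reasoning

-- The entry of column j at n = j has no partner in column j + 1. It equals the initial boundary
-- value, so the telescoping starts without remainder.
term-zero : ∀ j → term 0 j ≡ boundary 0 j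
term-zero j = begin
  coeff (j ℕ.+ 0) * mult 0 j
    ≡⟨ cong₂ (λ n b → coeff n * (A₁ * b)) (ℕ.+-identityʳ j) (binom-zero j) ⟩
  coeff j * (A₁ * 1ℚ)
    ≡⟨ linear-combination 5
         (λ { (J ∷ A₁ ∷ A₂ ∷ a ∷ a′ ∷ []) →
           ((κ 3 :* J :+ κ 2) :* a :* (A₁ :* κ 1) := κ 8 :* (κ 2 :* (κ 1 :+ J) :+ κ 1) :* a′ :* (A₂ :* κ 1)) ,
           (:- con 1ℚ :* κ 2 :* A₂ , (κ 4 :* (κ 2 :* J :+ κ 3) :* a′ := (κ 1 :+ J) :* a)) ∷
           (:- con 1ℚ :* a , ((κ 1 :+ (κ 1 :+ κ 3 :* J :+ κ 0) :- J) :* A₂ := (κ 1 :+ (κ 1 :+ κ 3 :* J :+ κ 0)) :* A₁)) ∷ [] })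
         (J ∷ A₁ ∷ A₂ ∷ amplitude j ∷ amplitude (suc j) ∷ []) refl
         (amplitude-suc j ∷ A₁-A₂ ∷ []) ⟩
  fromℕ 8 * (fromℕ 2 * (1ℚ + J) + 1ℚ) * amplitude (suc j) * (A₂ * 1ℚ)
    ≡⟨ cong (λ z → fromℕ 8 * (fromℕ 2 * z + 1ℚ) * amplitude (suc j) * (A₂ * 1ℚ)) (fromℕ-suc j) ⟨
  fromℕ 8 * (fromℕ 2 * fromℕ (suc j) + 1ℚ) * amplitude (suc j) * (A₂ * 1ℚ)
    ≡⟨ cong₂ (λ n b → fromℕ 8 * (fromℕ 2 * fromℕ (suc n) + 1ℚ) * amplitude (suc n) * (A₂ * b)) (ℕ.+-identityʳ j) (binom-zero (suc j)) ⟨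
  boundary 0 j ∎
  where
  open ≡-Reasoning
  open Shifts 0 j

-- Telescopes `term-shift` over i < k. Both sums stop at n = j + k; the one over column j has an
-- extra entry because it starts at n = j.
column-suc : ∀ k j → column k (suc j) ≡ column (suc k) j - boundary k j
column-suc zero    j = begin
  0ℚ                                ≡⟨ +-inverseʳ (boundary 0 j) ⟨
  boundary 0 j - boundary 0 j       ≡⟨ cong (_- boundary 0 j) (trans (+-identityˡ (term 0 j)) (term-zero j)) ⟨
  0ℚ + term 0 j - boundary 0 j      ∎
  where open ≡-Reasoning
column-suc (suc k) j = linear-combination 6
  (λ { (c ∷ c′ ∷ t ∷ t′ ∷ b ∷ b′ ∷ []) →
    (c′ :+ t′ := c :+ t :- b′) ,
    (κ 1 , (c′ := c :- b)) ∷
    (κ 1 , (t′ :- t := b :- b′)) ∷ [] })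
  (column (suc k) j ∷ column k (suc j) ∷ term (suc k) j ∷ term k (suc j) ∷ boundary k j ∷ boundary (suc k) j ∷ []) refl
  (column-suc k j ∷ term-shift k j ∷ [])

column-0 : ∀ k → column (suc k) 0 ≡ fromℕ 2
column-0 zero    = refl
column-0 (suc k) = begin
  column (suc k) 0 + c * (1ℚ * binom 0 (suc k))  ≡⟨ cong₂ (λ x y → x + c * (1ℚ * y)) (column-0 k) (binom-vanish {0} {suc k} (ℕ.s≤s ℕ.z≤n)) ⟩
  fromℕ 2 + c * (1ℚ * 0ℚ)                        ≡⟨ solve 1 (λ c → κ 2 :+ c :* (κ 1 :* κ 0) := κ 2) refl c ⟩
  fromℕ 2                                        ∎
  where
  open ≡-Reasoning
  c : ℚ
  c = coeff (suc k)

-- Induction on j carries the sum to column 0, whose only nonzero entry is e(0, 0) = 2; each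
-- boundary value on the way lies beyond the support of its binomial.
column-complete : ∀ {k j} → j ℕ.< k → column k j ≡ fromℕ 2
column-complete {suc k} {zero}  _   = column-0 k
column-complete {k}     {suc j} j<k = begin
  column k (suc j)                    ≡⟨ column-suc k j ⟩
  column (suc k) j - boundary k j     ≡⟨ cong₂ _-_ (column-complete (ℕ.m<n⇒m<1+n (ℕ.<-trans (ℕ.n<1+n j) j<k))) (boundary-vanish j<k) ⟩
  fromℕ 2 - 0ℚ                        ≡⟨⟩
  fromℕ 2                             ∎
  where open ≡-Reasoning

-- By `column-suc`, a column is the preceding one minus a nonnegative boundary value, so truncation
-- never exceeds the full sum.
column-≤ : ∀ k j → column k j ≤ fromℕ 2
column-≤ zero    zero    = 0≤fromℕ 2
column-≤ (suc k) zero    = ≤-reflexive (column-0 k)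
column-≤ k       (suc j) = begin
  column k (suc j)                    ≡⟨ column-suc k j ⟩
  column (suc k) j - boundary k j     ≤⟨ +-mono-≤ (column-≤ (suc k) j) (neg-antimono-≤ (0≤boundary k j)) ⟩
  fromℕ 2 - 0ℚ                        ≡⟨⟩
  fromℕ 2                             ∎
  where open ≤-Reasoning

0≤column : ∀ k j → 0ℚ ≤ column k j
0≤column zero    j = ≤-refl
0≤column (suc k) j = 0≤p+q (0≤column k j) (0≤term k j)

-- Summation over j

∑<-cong : ∀ n {f g} → (∀ k → k ℕ.< n → f k ≡ g k) → ∑< n f ≡ ∑< n g
∑<-cong zero    f≡g = refl
∑<-cong (suc n) f≡g = cong₂ _+_ (∑<-cong n (λ k k<n → f≡g k (ℕ.m<n⇒m<1+n k<n))) (f≡g n (ℕ.n<1+n n))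

∑<-+ : ∀ n f g → ∑< n (λ k → f k + g k) ≡ ∑< n f + ∑< n g
∑<-+ zero    f g = refl
∑<-+ (suc n) f g = trans (cong (_+ (f n + g n)) (∑<-+ n f g))
  (solve 4 (λ F G f g → F :+ G :+ (f :+ g) := F :+ f :+ (G :+ g)) refl (∑< n f) (∑< n g) (f n) (g n))

∑<-*ˡ : ∀ n c f → ∑< n (λ k → c * f k) ≡ c * ∑< n f
∑<-*ˡ zero    c f = sym (*-zeroʳ c)
∑<-*ˡ (suc n) c f = trans (cong (_+ c * f n) (∑<-*ˡ n c f)) (sym (*-distribˡ-+ c (∑< n f) (f n)))

∑<-linear : ∀ n a b f g → ∑< n (λ k → a * f k + b * g k) ≡ a * ∑< n f + b * ∑< n g
∑<-linear n a b f g =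
  trans (∑<-+ n (λ k → a * f k) (λ k → b * g k)) (cong₂ _+_ (∑<-*ˡ n a f) (∑<-*ˡ n b g))

-- Row sums and their recurrences.

sgn : ℕ → ℚ
sgn k = (- 1ℚ) ^ k

odd⁻² : ℕ → ℚ
odd⁻² j = ℤ.+ 1 / (1 ℕ.+ 2 ℕ.* j) ℕ.^ 2

odd⁻²-inverse : ∀ j → (fromℕ 2 * fromℕ j + 1ℚ) * (fromℕ 2 * fromℕ j + 1ℚ) * odd⁻² j ≡ 1ℚ
odd⁻²-inverse j = trans (cong (λ z → z * z * odd⁻² j) (sym (fromℕ-odd 1 j))) (reciprocal-sq (1 ℕ.+ 2 ℕ.* j))

μ : ℕ → ℕ → ℚ
μ n j = mult (n ℕ.∸ j) j

μ-+ : ∀ j i → μ (j ℕ.+ i) j ≡ mult i j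
μ-+ j i = cong (λ k → mult k j) (ℕ.m+n∸m≡n j i)

μ-suc : ∀ j i → μ (suc (j ℕ.+ i)) j ≡ mult (suc i) j
μ-suc j i = trans (cong (λ n → μ n j) (sym (ℕ.+-suc j i))) (μ-+ j (suc i))

-- S n / R n = (ratio n / ratio (suc n))².
S R : ℚ → ℚ
S N = (fromℕ 2 * N + fromℕ 3) * (fromℕ 2 * N + fromℕ 3)
R N = fromℕ 4 * ((1ℚ + N) * (1ℚ + N))

-- Up to the common factor coeff n, the coefficients of x⁰ and x² in the partial
-- fraction expansion of t(n, x).
row₁-term row₂-term : ℕ → ℕ → ℚ
row₁-term n j = sgn j * (odd⁻² j * μ n j)
row₂-term n j = sgn j * (odd⁻² j * odd⁻² j * μ n j)

row₁ row₂ : ℕ → ℚ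
row₁ n = ∑< (suc n) (row₁-term n)
row₂ n = ∑< (suc n) (row₂-term n)

-- Summed over j ≤ n, this is the left side of the recurrence `row₁-suc`, except for the entry j = n
-- + 1 of row n + 1.
kernel : ℚ → ℕ → ℕ → ℚ
kernel N n j = S N * row₁-term (suc n) j + R N * row₁-term n j

-- Antidifference in j of (1 + N)(2N + 3) times `kernel`, at n = i + j.
antidifference : ℚ → ℕ → ℕ → ℚ
antidifference N i j =
  sgn j * ((fromℕ 3 * N + fromℕ 4) * ((1ℚ + fromℕ j) * (binom (3 ℕ.+ (j ℕ.* 3 ℕ.+ i)) (suc j) * binom j i)))

-- Here n is fixed, so `i` drops by one as `j` rises; by `wz₂` the right sides differ by the added
-- kernel entry.
kernel-sum-step : ∀ j i {N} → let n = suc (j ℕ.+ i) in N ≡ 1ℚ + fromℕ j + fromℕ i →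
  (1ℚ + N) * (fromℕ 2 * N + fromℕ 3) * ∑< (suc j) (kernel N n) ≡ antidifference N (suc i) j →
  (1ℚ + N) * (fromℕ 2 * N + fromℕ 3) * ∑< (suc (suc j)) (kernel N n) ≡ antidifference N i (suc j)
kernel-sum-step j i {N} refl hyp = linear-combination 15
  (λ { (s ∷ J ∷ I ∷ J′ ∷ u ∷ A₄ ∷ A₅ ∷ A₆ ∷ B₁₀ ∷ B₁₁ ∷ B₀₁ ∷ m ∷ m′ ∷ Σ ∷ a ∷ []) →
    let N = κ 1 :+ J :+ I
        K = (κ 1 :+ N) :* (κ 2 :* N :+ κ 3)
        S = (κ 2 :* N :+ κ 3) :* (κ 2 :* N :+ κ 3)
        Q = κ 4 :* ((κ 1 :+ N) :* (κ 1 :+ N))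
        M = κ 3 :* N :+ κ 4
    in (K :* (Σ :+ (S :* ((:- κ 1 :* s) :* (u :* m′)) :+ Q :* ((:- κ 1 :* s) :* (u :* m)))) :=
          (:- κ 1 :* s) :* (M :* ((κ 1 :+ J′) :* (A₆ :* B₁₀)))) ,
       (κ 1 , (K :* Σ := s :* (M :* ((κ 1 :+ J) :* (a :* B₀₁))))) ∷
       (s :* M :* (κ 1 :+ J) :* B₀₁ , (a := A₄)) ∷
       (:- s , (K :* (u :* (S :* (A₅ :* B₁₁) :+ Q :* (A₄ :* B₁₀))) :=
                  M :* ((κ 1 :+ (κ 1 :+ J)) :* (A₆ :* B₁₀) :+ (κ 1 :+ J) :* (A₄ :* B₀₁)))) ∷
       (:- K :* S :* s :* u , (m′ := A₅ :* B₁₁)) ∷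
       (:- K :* Q :* s :* u , (m := A₄ :* B₁₀)) ∷
       (s :* M :* A₆ :* B₁₀ , (J′ := κ 1 :+ J)) ∷ [] })
  (sgn j ∷ J ∷ I ∷ fromℕ (suc j) ∷ odd⁻² (suc j) ∷ A₄ ∷ A₅ ∷ A₆ ∷ B₁₀ ∷ B₁₁ ∷ B₀₁ ∷ μ n (suc j) ∷ μ (suc n) (suc j)
    ∷ ∑< (suc j) (kernel N n) ∷ binom (3 ℕ.+ (j ℕ.* 3 ℕ.+ suc i)) (suc j) ∷ []) refl
  ( hyp
  ∷ cong (λ t → binom (3 ℕ.+ t) (suc j)) (ℕ.+-suc (j ℕ.* 3) i)
  ∷ wz₂ (subst (λ z → (fromℕ 2 * z + 1ℚ) * (fromℕ 2 * z + 1ℚ) * odd⁻² (suc j) ≡ 1ℚ) (fromℕ-suc j) (odd⁻²-inverse (suc j)))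
  ∷ trans (μ-suc (suc j) i) mult-suc-suc
  ∷ μ-+ (suc j) i
  ∷ fromℕ-suc j ∷ [])
  where
  open Shifts i j
  n : ℕ
  n = suc (j ℕ.+ i)

kernel-sum : ∀ j i n N → n ≡ j ℕ.+ i → fromℕ n ≡ N →
  (1ℚ + N) * (fromℕ 2 * N + fromℕ 3) * ∑< (suc j) (kernel N n) ≡ antidifference N i j
kernel-sum zero    zero    _ _ refl refl = refl
-- For n > 0 every product in column 0 has a factor C(0, m) with m > 0, so both sides are zero.
kernel-sum zero    (suc i) n N refl refl = begin
  K * (0ℚ + (S N * (1ℚ * (1ℚ * (b₁ * binom 0 (suc n)))) + R N * (1ℚ * (1ℚ * (b₂ * binom 0 n)))))
    ≡⟨ cong₂ (λ y z → K * (0ℚ + (S N * (1ℚ * (1ℚ * (b₁ * y))) + R N * (1ℚ * (1ℚ * (b₂ * z)))))) (vanish n) (vanish i) ⟩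
  K * (0ℚ + (S N * (1ℚ * (1ℚ * (b₁ * 0ℚ))) + R N * (1ℚ * (1ℚ * (b₂ * 0ℚ)))))
    ≡⟨ solve 7 (λ k s r b₁ b₂ b₃ m → k :* (κ 0 :+ (s :* (κ 1 :* (κ 1 :* (b₁ :* κ 0))) :+ r :* (κ 1 :* (κ 1 :* (b₂ :* κ 0)))))
         := κ 1 :* (m :* ((κ 1 :+ κ 0) :* (b₃ :* κ 0)))) refl K (S N) (R N) b₁ b₂ b₃ M ⟩
  1ℚ * (M * ((1ℚ + 0ℚ) * (b₃ * 0ℚ)))
    ≡⟨ cong (λ z → 1ℚ * (M * ((1ℚ + 0ℚ) * (b₃ * z)))) (vanish i) ⟨
  1ℚ * (M * ((1ℚ + 0ℚ) * (b₃ * binom 0 n))) ∎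
  where
  open ≡-Reasoning
  K M b₁ b₂ b₃ : ℚ
  K  = (1ℚ + N) * (fromℕ 2 * N + fromℕ 3)
  M  = fromℕ 3 * N + fromℕ 4
  b₁ = binom (suc (suc n)) 0
  b₂ = binom (suc n) 0
  b₃ = binom (3 ℕ.+ n) 1
  vanish : ∀ k → binom 0 (suc k) ≡ 0ℚ
  vanish k = binom-vanish {0} {suc k} (ℕ.s≤s ℕ.z≤n)
kernel-sum (suc j) i n N refl n≡N =
  kernel-sum-step j i (trans (sym n≡N) (fromℕ-1+j+i i j)) (kernel-sum j (suc i) n N (sym (ℕ.+-suc j i)) n≡N)

-- At j = n, `kernel-sum` leaves the antidifference with i = 0, and the entry j = n + 1 of row n + 1
-- cancels it.
row₁-suc : ∀ n → S (fromℕ n) * row₁ (suc n) + R (fromℕ n) * row₁ n ≡ 0ℚ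
row₁-suc n = *-cancelˡ-≡ (0<p*q 0<1+J (0<3+2n n)) (linear-combination 11
  (λ { (s ∷ N ∷ u ∷ A₃ ∷ A₄ ∷ X ∷ X′ ∷ P ∷ Σ ∷ N′ ∷ b ∷ []) →
    let K = (κ 1 :+ N) :* (κ 2 :* N :+ κ 3)
        S = (κ 2 :* N :+ κ 3) :* (κ 2 :* N :+ κ 3)
        Q = κ 4 :* ((κ 1 :+ N) :* (κ 1 :+ N))
        M = κ 3 :* N :+ κ 4
    in (K :* (S :* X′ :+ Q :* X) := K :* κ 0) ,
       (κ 1 , (K :* Σ := s :* (M :* ((κ 1 :+ N) :* (A₃ :* b))))) ∷
       (s :* M :* (κ 1 :+ N) :* A₃ , (b := κ 1)) ∷
       (:- K , (Σ := S :* P :+ Q :* X)) ∷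
       (K :* S , (X′ := P :+ (:- κ 1 :* s) :* (u :* (A₄ :* κ 1)))) ∷
       (:- K :* s :* A₄ , ((κ 2 :* (κ 1 :+ N) :+ κ 1) :* (κ 2 :* (κ 1 :+ N) :+ κ 1) :* u := κ 1)) ∷
       (:- s :* (κ 1 :+ N) , ((κ 1 :+ (κ 3 :+ κ 3 :* N :+ κ 0) :- (κ 1 :+ N)) :* A₄ := (κ 1 :+ (κ 3 :+ κ 3 :* N :+ κ 0)) :* A₃)) ∷ [] })
  (sgn n ∷ J ∷ odd⁻² (suc n) ∷ binom (3 ℕ.+ t) (suc n) ∷ A₄ ∷ row₁ n ∷ row₁ (suc n) ∷ P ∷ ∑< (suc n) (kernel J n) ∷ J ∷ binom n 0 ∷ []) refl
  ( kernel-sum n 0 n J (sym (ℕ.+-identityʳ n)) refl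
  ∷ binom-zero n
  ∷ ∑<-linear (suc n) (S J) (R J) (row₁-term (suc n)) (row₁-term n)
  ∷ cong (λ z → P + sgn (suc n) * (odd⁻² (suc n) * z)) μ-diagonal
  ∷ subst (λ z → (fromℕ 2 * z + 1ℚ) * (fromℕ 2 * z + 1ℚ) * odd⁻² (suc n) ≡ 1ℚ) (fromℕ-suc n) (odd⁻²-inverse (suc n))
  ∷ binom-upper′ (3 ℕ.+ t) (suc n) (fromℕ-t 3) (fromℕ-suc n) ∷ []))
  where
  open Shifts 0 n
  P : ℚ
  P = ∑< (suc n) (row₁-term (suc n))
  μ-diagonal : μ (suc n) (suc n) ≡ A₄ * 1ℚ
  μ-diagonal = trans (cong (λ k → mult k (suc n)) (ℕ.n∸n≡0 n)) (cong (A₄ *_) (binom-zero (suc n)))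

-- The recurrence `row₁-suc` has order one, and S and R are the squares of the two factors in
-- `ratio-suc`.
row₁-value : ∀ n → row₁ n ≡ sgn n * (ratio n * ratio n)
row₁-value zero    = refl
row₁-value (suc n) = *-cancelˡ-≡ (0<p*q (0<3+2n n) (0<3+2n n)) (linear-combination 6
  (λ { (N ∷ s ∷ r ∷ r′ ∷ X ∷ X′ ∷ []) →
    let S = (κ 2 :* N :+ κ 3) :* (κ 2 :* N :+ κ 3)
        Q = κ 4 :* ((κ 1 :+ N) :* (κ 1 :+ N))
    in (S :* X′ := S :* ((:- κ 1 :* s) :* (r′ :* r′))) ,
       (κ 1 , (S :* X′ :+ Q :* X := κ 0)) ∷
       (:- Q , (X := s :* (r :* r))) ∷
       -- Difference of squares: the equation a = b is multiplied by a + b.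
       (s :* ((κ 2 :* N :+ κ 3) :* r′ :+ κ 2 :* (κ 1 :+ N) :* r) , ((κ 2 :* N :+ κ 3) :* r′ := κ 2 :* (κ 1 :+ N) :* r)) ∷ [] })
  (fromℕ n ∷ sgn n ∷ ratio n ∷ ratio (suc n) ∷ row₁ n ∷ row₁ (suc n) ∷ []) refl
  (row₁-suc n ∷ row₁-value n ∷ ratio-suc n ∷ []))

-- Put d = 2j + 1. The factors in `mult-step`, times 4, are S n - d² and 4d² - R n, so S n · μ (n +
-- 1) j + R n · μ n j = d² (μ (n + 1) j + 4 μ n j). The d² cancels one `odd⁻² j`.
row₂-term-step : ∀ {n j} → j ℕ.≤ n →
  S (fromℕ n) * row₂-term (suc n) j + R (fromℕ n) * row₂-term n j ≡ 1ℚ * row₁-term (suc n) j + fromℕ 4 * row₁-term n j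
row₂-term-step {n} {j} j≤n = subst
  (λ k → S (fromℕ k) * row₂-term (suc k) j + R (fromℕ k) * row₂-term k j ≡ 1ℚ * row₁-term (suc k) j + fromℕ 4 * row₁-term k j)
  (ℕ.m+[n∸m]≡n j≤n) (row₂-term-step-+ j (n ℕ.∸ j))
  where
  row₂-term-step-+ : ∀ j i → let n = j ℕ.+ i in
    S (fromℕ n) * row₂-term (suc n) j + R (fromℕ n) * row₂-term n j ≡ 1ℚ * row₁-term (suc n) j + fromℕ 4 * row₁-term n j
  row₂-term-step-+ j i = subst
    (λ N → S N * row₂-term (suc k) j + R N * row₂-term k j ≡ 1ℚ * row₁-term (suc k) j + fromℕ 4 * row₁-term k j)
    (sym (fromℕ-+ j i)) (linear-combination 6
    (λ { (s ∷ J ∷ I ∷ u ∷ m ∷ m′ ∷ []) →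
      let N = J :+ I
          S = (κ 2 :* N :+ κ 3) :* (κ 2 :* N :+ κ 3)
          Q = κ 4 :* ((κ 1 :+ N) :* (κ 1 :+ N))
      in (S :* (s :* (u :* u :* m′)) :+ Q :* (s :* (u :* u :* m)) :=
            κ 1 :* (s :* (u :* m′)) :+ κ 4 :* (s :* (u :* m))) ,
         (κ 4 :* s :* u :* u , ((κ 1 :+ I) :* (κ 2 :+ κ 2 :* J :+ I) :* m′ := (J :- I) :* (κ 2 :+ κ 3 :* J :+ I) :* m)) ∷
         (s :* u :* (m′ :+ κ 4 :* m) , ((κ 2 :* J :+ κ 1) :* (κ 2 :* J :+ κ 1) :* u := κ 1)) ∷ [] })
    (sgn j ∷ J ∷ I ∷ odd⁻² j ∷ μ k j ∷ μ (suc k) j ∷ []) refl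
    (subst₂ (λ m m′ → (1ℚ + I) * (fromℕ 2 + fromℕ 2 * J + I) * m′ ≡ (J - I) * (fromℕ 2 + fromℕ 3 * J + I) * m)
       (sym (μ-+ j i)) (sym (μ-suc j i)) mult-step ∷ odd⁻²-inverse j ∷ []))
    where
    open Shifts i j
    k : ℕ
    k = j ℕ.+ i

row₂-suc : ∀ n → S (fromℕ n) * row₂ (suc n) + R (fromℕ n) * row₂ n ≡ row₁ (suc n) + fromℕ 4 * row₁ n
row₂-suc n = linear-combination 9
  (λ { (N ∷ s ∷ u ∷ m ∷ X ∷ Y ∷ P ∷ Q ∷ Z ∷ []) →
    let S = (κ 2 :* N :+ κ 3) :* (κ 2 :* N :+ κ 3)
        R = κ 4 :* ((κ 1 :+ N) :* (κ 1 :+ N))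
    in (S :* (Q :+ s :* (u :* u :* m)) :+ R :* Y := (P :+ s :* (u :* m)) :+ κ 4 :* X) ,
       (:- κ 1 , (Z := S :* Q :+ R :* Y)) ∷
       (κ 1 , (Z := κ 1 :* P :+ κ 4 :* X)) ∷
       -- At j = n + 1 the odd number 2j + 1 is 2n + 3, so S n · u = 1 and the last entry of `row₂`
       -- turns into that of `row₁`.
       (s :* u :* m , ((κ 2 :* (κ 1 :+ N) :+ κ 1) :* (κ 2 :* (κ 1 :+ N) :+ κ 1) :* u := κ 1)) ∷ [] })
  (fromℕ n ∷ sgn (suc n) ∷ odd⁻² (suc n) ∷ μ (suc n) (suc n) ∷ row₁ n ∷ row₂ n ∷ ∑< (suc n) (row₁-term (suc n)) ∷ ∑< (suc n) (row₂-term (suc n))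
    ∷ ∑< (suc n) (λ j → S (fromℕ n) * row₂-term (suc n) j + R (fromℕ n) * row₂-term n j) ∷ []) refl
  ( ∑<-linear (suc n) (S (fromℕ n)) (R (fromℕ n)) (row₂-term (suc n)) (row₂-term n)
  ∷ trans (∑<-cong (suc n) (λ j j<1+n → row₂-term-step (ℕ.≤-pred j<1+n))) (∑<-linear (suc n) 1ℚ (fromℕ 4) (row₁-term (suc n)) (row₁-term n))
  ∷ subst (λ z → (fromℕ 2 * z + 1ℚ) * (fromℕ 2 * z + 1ℚ) * odd⁻² (suc n) ≡ 1ℚ) (fromℕ-suc n) (odd⁻²-inverse (suc n)) ∷ [])

-- The harmonic factor.

harmonic : ℕ → ℚ
harmonic n = H⁽²⁾ (1 ℕ.+ 2 ℕ.* n) - (ℤ.+ 5 / 4) * H⁽²⁾ n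

-- The increment 1/(2n + 2)² + 1/(2n + 3)² - (5/4)/(n + 1)² collapses to 1/(2n + 3)² - 1/(n + 1)²:
-- the even term uses up the 1/4 in 5/4.
harmonic-suc : ∀ n → S (fromℕ n) * ((1ℚ + fromℕ n) * (1ℚ + fromℕ n)) * harmonic (suc n)
            ≡ S (fromℕ n) * ((1ℚ + fromℕ n) * (1ℚ + fromℕ n)) * harmonic n + ((1ℚ + fromℕ n) * (1ℚ + fromℕ n) - S (fromℕ n))
harmonic-suc n = linear-combination 7
  (λ { (N ∷ Ho ∷ Ho′ ∷ H ∷ v ∷ v′ ∷ w ∷ []) →
    let S = (κ 2 :* N :+ κ 3) :* (κ 2 :* N :+ κ 3)
        V = (κ 1 :+ N) :* (κ 1 :+ N)
        q = con (ℤ.+ 5 / 4)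
    in (S :* V :* (Ho′ :- q :* (H :+ v)) := S :* V :* (Ho :- q :* H) :+ (V :- S)) ,
       (S :* V , (Ho′ := Ho :+ v′ :+ w)) ∷
       (con (ℤ.+ 1 / 4) :* S , ((κ 2 :* N :+ κ 2) :* (κ 2 :* N :+ κ 2) :* v′ := κ 1)) ∷
       (V , ((κ 2 :* N :+ κ 3) :* (κ 2 :* N :+ κ 3) :* w := κ 1)) ∷
       (:- q :* S , ((κ 1 :+ N) :* (κ 1 :+ N) :* v := κ 1)) ∷ [] })
  (fromℕ n ∷ H⁽²⁾ (1 ℕ.+ 2 ℕ.* n) ∷ H⁽²⁾ (1 ℕ.+ 2 ℕ.* suc n) ∷ H⁽²⁾ n
    ∷ (ℤ.+ 1 / suc n ℕ.^ 2) ∷ (ℤ.+ 1 / (2 ℕ.+ 2 ℕ.* n) ℕ.^ 2) ∷ (ℤ.+ 1 / (3 ℕ.+ 2 ℕ.* n) ℕ.^ 2) ∷ []) refl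
  ( cong (λ k → H⁽²⁾ (suc k)) (ℕ.*-suc 2 n)
  ∷ subst (λ z → z * z * (ℤ.+ 1 / (2 ℕ.+ 2 ℕ.* n) ℕ.^ 2) ≡ 1ℚ) (fromℕ-odd 2 n) (reciprocal-sq (2 ℕ.+ 2 ℕ.* n))
  ∷ subst (λ z → z * z * (ℤ.+ 1 / (3 ℕ.+ 2 ℕ.* n) ℕ.^ 2) ≡ 1ℚ) (fromℕ-odd 3 n) (reciprocal-sq (3 ℕ.+ 2 ℕ.* n))
  ∷ subst (λ z → z * z * (ℤ.+ 1 / suc n ℕ.^ 2) ≡ 1ℚ) (fromℕ-suc n) (reciprocal-sq (suc n)) ∷ [])

-- Variation of constants: with row₂ = row₁ · h in `row₂-suc`, eliminating R n · row₁ n by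
-- `row₁-suc` leaves exactly the increment of `harmonic` for h.
row₂-value : ∀ n → row₂ n ≡ row₁ n * harmonic n
row₂-value zero    = refl
row₂-value (suc n) = *-cancelˡ-≡ (0<p*q (0<p*q (0<3+2n n) (0<3+2n n)) (0<p*q 0<1+n 0<1+n)) (linear-combination 7
  (λ { (N ∷ X ∷ X′ ∷ Y ∷ Y′ ∷ h ∷ h′ ∷ []) →
    let S = (κ 2 :* N :+ κ 3) :* (κ 2 :* N :+ κ 3)
        V = (κ 1 :+ N) :* (κ 1 :+ N)
        R = κ 4 :* V
    in (S :* V :* Y′ := S :* V :* (X′ :* h′)) ,
       (V , (S :* Y′ :+ R :* Y := X′ :+ κ 4 :* X)) ∷
       (:- V :* R , (Y := X :* h)) ∷
       (κ 1 :- V :* h , (S :* X′ :+ R :* X := κ 0)) ∷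
       (:- X′ , (S :* V :* h′ := S :* V :* h :+ (V :- S))) ∷ [] })
  (fromℕ n ∷ row₁ n ∷ row₁ (suc n) ∷ row₂ n ∷ row₂ (suc n) ∷ harmonic n ∷ harmonic (suc n) ∷ []) refl
  (row₂-suc n ∷ row₂-value n ∷ row₁-suc n ∷ harmonic-suc n ∷ []))
  where
  0<1+n : 0ℚ < 1ℚ + fromℕ n
  0<1+n = 0<p+q 0<1 (0≤fromℕ n)

-- The summand as a weighted row sum.

÷-unique : ∀ {p} q .{{_ : NonZero q}} z → z * q ≡ p → p ÷ q ≡ z
÷-unique q z refl = begin
  z * q * 1/ q     ≡⟨ *-assoc z q (1/ q) ⟩
  z * (q * 1/ q)   ≡⟨ cong (z *_) (*-inverseʳ q) ⟩
  z * 1ℚ           ≡⟨ *-identityʳ z ⟩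
  z                ∎
  where open ≡-Reasoning

ratio-poch : ∀ n → ratio n * poch 3/2 n ≡ poch 1ℚ n
ratio-poch zero    = refl
ratio-poch (suc n) = linear-combination 5
  (λ { (N ∷ r ∷ r′ ∷ p ∷ q ∷ []) →
    (r′ :* (q :* (con 3/2 :+ N)) := p :* (κ 1 :+ N)) ,
    (con ½ :* q , ((κ 2 :* N :+ κ 3) :* r′ := κ 2 :* (κ 1 :+ N) :* r)) ∷
    (κ 1 :+ N , (r :* q := p)) ∷ [] })
  (fromℕ n ∷ ratio n ∷ ratio (suc n) ∷ poch 1ℚ n ∷ poch 3/2 n ∷ []) refl
  (ratio-suc n ∷ ratio-poch n ∷ [])

-8^-inverse : ∀ n → sgn n * ⅛ ^ n * -8ℚ ^ n ≡ 1ℚ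
-8^-inverse zero    = refl
-8^-inverse (suc n) = trans
  (solve 3 (λ s e E → (:- κ 1 :* s) :* (con ⅛ :* e) :* (con -8ℚ :* E) := s :* e :* E) refl (sgn n) (⅛ ^ n) (-8ℚ ^ n))
  (-8^-inverse n)

-- Of the three factors `ratio n`, one goes into `coeff n`; the other two, with the sign, form
-- `row₁ n`.
summand-coeff : ∀ n → summand n ≡ coeff n * row₂ n
summand-coeff n = begin
  summand n
    ≡⟨ cong₂ (λ p q → p * q * harmonic n)
         (÷-unique (-8ℚ ^ n) {{^-nonZero -8ℚ n}} ((fromℕ 3 * N + fromℕ 2) * (s * e)) power)
         (÷-unique (q ^ 3) {{^-nonZero q 3 {{pos⇒nonZero q {{poch-pos 3/2 n}}}}}} (r * (r * r)) cube) ⟩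
  (fromℕ 3 * N + fromℕ 2) * (s * e) * (r * (r * r)) * harmonic n
    ≡⟨ solve 5 (λ n s e r h → (κ 3 :* n :+ κ 2) :* (s :* e) :* (r :* (r :* r)) :* h
                 := (κ 3 :* n :+ κ 2) :* (r :* e) :* (s :* (r :* r) :* h)) refl N s e r (harmonic n) ⟩
  coeff n * (s * (r * r) * harmonic n)
    ≡⟨ cong (λ z → coeff n * (z * harmonic n)) (row₁-value n) ⟨
  coeff n * (row₁ n * harmonic n)
    ≡⟨ cong (coeff n *_) (row₂-value n) ⟨
  coeff n * row₂ n ∎
  where
  open ≡-Reasoning
  N s e r q : ℚ
  N = fromℕ n
  s = sgn n
  e = ⅛ ^ n
  r = ratio n
  q = poch 3/2 n
  power : (fromℕ 3 * N + fromℕ 2) * (s * e) * -8ℚ ^ n ≡ fromℕ (2 ℕ.+ 3 ℕ.* n)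
  power = begin
    (fromℕ 3 * N + fromℕ 2) * (s * e) * -8ℚ ^ n    ≡⟨ *-assoc (fromℕ 3 * N + fromℕ 2) (s * e) (-8ℚ ^ n) ⟩
    (fromℕ 3 * N + fromℕ 2) * (s * e * -8ℚ ^ n)    ≡⟨ cong ((fromℕ 3 * N + fromℕ 2) *_) (-8^-inverse n) ⟩
    (fromℕ 3 * N + fromℕ 2) * 1ℚ                   ≡⟨ solve 1 (λ n → (κ 3 :* n :+ κ 2) :* κ 1 := κ 2 :+ κ 3 :* n) refl N ⟩
    fromℕ 2 + fromℕ 3 * N                          ≡⟨ cong (fromℕ 2 +_) (fromℕ-* 3 n) ⟨
    fromℕ 2 + fromℕ (3 ℕ.* n)                      ≡⟨ fromℕ-+ 2 (3 ℕ.* n) ⟨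
    fromℕ (2 ℕ.+ 3 ℕ.* n)                          ∎
  cube : r * (r * r) * q ^ 3 ≡ poch 1ℚ n ^ 3
  cube = trans
    (solve 2 (λ r q → r :* (r :* r) :* (q :* (q :* (q :* κ 1))) := (r :* q) :* ((r :* q) :* ((r :* q) :* κ 1))) refl r q)
    (cong (_^ 3) (ratio-poch n))

odd⁻⁴ : ℕ → ℚ
odd⁻⁴ j = odd⁻² j * odd⁻² j

summand-row : ∀ n → summand n ≡ ∑< (suc n) (λ j → sgn j * (odd⁻⁴ j * term (n ℕ.∸ j) j))
summand-row n = begin
  summand n                                                  ≡⟨ summand-coeff n ⟩
  coeff n * row₂ n                                              ≡⟨ ∑<-*ˡ (suc n) (coeff n) (row₂-term n) ⟨
  ∑< (suc n) (λ j → coeff n * row₂-term n j)                         ≡⟨ ∑<-cong (suc n) (λ j j<1+n → pointwise j (ℕ.≤-pred j<1+n)) ⟩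
  ∑< (suc n) (λ j → sgn j * (odd⁻⁴ j * term (n ℕ.∸ j) j))        ∎
  where
  open ≡-Reasoning
  pointwise : ∀ j → j ℕ.≤ n → coeff n * row₂-term n j ≡ sgn j * (odd⁻⁴ j * term (n ℕ.∸ j) j)
  pointwise j j≤n = begin
    coeff n * (sgn j * (odd⁻⁴ j * μ n j))
      ≡⟨ solve 4 (λ c s w m → c :* (s :* (w :* m)) := s :* (w :* (c :* m))) refl (coeff n) (sgn j) (odd⁻⁴ j) (μ n j) ⟩
    sgn j * (odd⁻⁴ j * (coeff n * μ n j))
      ≡⟨ cong (λ k → sgn j * (odd⁻⁴ j * (coeff k * μ n j))) (ℕ.m+[n∸m]≡n j≤n) ⟨
    sgn j * (odd⁻⁴ j * (coeff (j ℕ.+ (n ℕ.∸ j)) * μ n j)) ∎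

-- Convergence

∑<-swap : ∀ N (f : ℕ → ℕ → ℚ) →
  ∑< N (λ n → ∑< (suc n) (λ j → f (n ℕ.∸ j) j)) ≡ ∑< N (λ j → ∑< (N ℕ.∸ j) (λ i → f i j))
∑<-swap zero    f = refl
∑<-swap (suc N) f = begin
  ∑< N (λ n → ∑< (suc n) (λ j → f (n ℕ.∸ j) j)) + diagonal
    ≡⟨ cong (_+ diagonal) (∑<-swap N f) ⟩
  columns + diagonal
    ≡⟨ cong (_+ diagonal) (+-identityʳ columns) ⟨
  -- Column N is still empty; including it lets the diagonal extend all N + 1 columns by one entry
  -- each.
  columns + ∑< 0 (λ i → f i N) + diagonal
    ≡⟨ cong (λ k → columns + ∑< k (λ i → f i N) + diagonal) (ℕ.n∸n≡0 N) ⟨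
  ∑< (suc N) (λ j → ∑< (N ℕ.∸ j) (λ i → f i j)) + diagonal
    ≡⟨ ∑<-+ (suc N) (λ j → ∑< (N ℕ.∸ j) (λ i → f i j)) (λ j → f (N ℕ.∸ j) j) ⟨
  ∑< (suc N) (λ j → ∑< (suc (N ℕ.∸ j)) (λ i → f i j))
    ≡⟨ ∑<-cong (suc N) (λ j j<1+N → cong (λ k → ∑< k (λ i → f i j)) (ℕ.+-∸-assoc 1 (ℕ.≤-pred j<1+N))) ⟨
  ∑< (suc N) (λ j → ∑< (suc N ℕ.∸ j) (λ i → f i j)) ∎
  where
  open ≡-Reasoning
  columns diagonal : ℚ
  columns  = ∑< N (λ j → ∑< (N ℕ.∸ j) (λ i → f i j))
  diagonal = ∑< (suc N) (λ j → f (N ℕ.∸ j) j)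

partial-sum : ∀ N → ∑< N summand ≡ ∑< N (λ j → sgn j * (odd⁻⁴ j * column (N ℕ.∸ j) j))
partial-sum N = begin
  ∑< N summand
    ≡⟨ ∑<-cong N (λ n _ → summand-row n) ⟩
  ∑< N (λ n → ∑< (suc n) (λ j → f (n ℕ.∸ j) j))
    ≡⟨ ∑<-swap N f ⟩
  ∑< N (λ j → ∑< (N ℕ.∸ j) (λ i → f i j))
    ≡⟨ ∑<-cong N (λ j _ → trans (∑<-*ˡ (N ℕ.∸ j) (sgn j) (λ i → odd⁻⁴ j * term i j))
                            (cong (sgn j *_) (∑<-*ˡ (N ℕ.∸ j) (odd⁻⁴ j) (λ i → term i j)))) ⟩
  ∑< N (λ j → sgn j * (odd⁻⁴ j * column (N ℕ.∸ j) j)) ∎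
  where
  open ≡-Reasoning
  f : ℕ → ℕ → ℚ
  f i j = sgn j * (odd⁻⁴ j * term i j)

-- Both sides are inverses of (2j + 1)⁴.
odd⁻⁴-reciprocal : ∀ j → odd⁻⁴ j ≡ ℤ.+ 1 / (1 ℕ.+ 2 ℕ.* j) ℕ.^ 4
odd⁻⁴-reciprocal j = linear-combination 3
  (λ { (D ∷ u ∷ v ∷ []) →
    (u :* u := v) ,
    (:- (u :* u) , (D :* (D :* (D :* (D :* κ 1))) :* v := κ 1)) ∷
    (v :* (D :* D :* u :+ κ 1) , (D :* D :* u := κ 1)) ∷ [] })
  (fromℕ d ∷ odd⁻² j ∷ (ℤ.+ 1 / d ℕ.^ 4) ∷ []) refl
  (trans (cong (_* (ℤ.+ 1 / d ℕ.^ 4)) (sym fromℕ-d⁴)) (*-reciprocal (d ℕ.^ 4)) ∷ reciprocal-sq d ∷ [])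
  where
  d : ℕ
  d = 1 ℕ.+ 2 ℕ.* j
  D : ℚ
  D = fromℕ d
  fromℕ-*d : ∀ {n q} → fromℕ n ≡ q → fromℕ (d ℕ.* n) ≡ D * q
  fromℕ-*d {n} refl = fromℕ-* d n
  fromℕ-d⁴ : fromℕ (d ℕ.^ 4) ≡ D * (D * (D * (D * 1ℚ)))
  fromℕ-d⁴ = fromℕ-*d {d ℕ.^ 3} (fromℕ-*d {d ℕ.^ 2} (fromℕ-*d {d ℕ.^ 1} (fromℕ-*d {1} refl)))

β4-partial : ℕ → ℚ
β4-partial n = ∑< n β4-term

β4-term-odd⁻⁴ : ∀ j → β4-term j ≡ sgn j * odd⁻⁴ j
β4-term-odd⁻⁴ j = cong (sgn j *_) (sym (odd⁻⁴-reciprocal j))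

partial-sum-error : ∀ N → ∑< N summand - fromℕ 2 * β4-partial N
                        ≡ ∑< N (λ j → sgn j * (odd⁻⁴ j * (column (N ℕ.∸ j) j - fromℕ 2)))
partial-sum-error N = begin
  ∑< N summand - fromℕ 2 * β4-partial N
    ≡⟨ cong₂ (λ p q → p - fromℕ 2 * q) (partial-sum N) (∑<-cong N (λ j _ → β4-term-odd⁻⁴ j)) ⟩
  ∑< N f - fromℕ 2 * ∑< N g
    ≡⟨ solve 2 (λ f g → f :- κ 2 :* g := κ 1 :* f :+ (:- κ 2) :* g) refl (∑< N f) (∑< N g) ⟩
  1ℚ * ∑< N f + (- fromℕ 2) * ∑< N g
    ≡⟨ ∑<-linear N 1ℚ (- fromℕ 2) f g ⟨
  ∑< N (λ j → 1ℚ * f j + (- fromℕ 2) * g j)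
    ≡⟨ ∑<-cong N (λ j _ → solve 3 (λ s w c → κ 1 :* (s :* (w :* c)) :+ (:- κ 2) :* (s :* w) := s :* (w :* (c :- κ 2))) refl
                             (sgn j) (odd⁻⁴ j) (column (N ℕ.∸ j) j)) ⟩
  ∑< N (λ j → sgn j * (odd⁻⁴ j * (column (N ℕ.∸ j) j - fromℕ 2))) ∎
  where
  open ≡-Reasoning
  f g : ℕ → ℚ
  f j = sgn j * (odd⁻⁴ j * column (N ℕ.∸ j) j)
  g j = sgn j * odd⁻⁴ j

∣∑<∣-≤ : ∀ n f c → (∀ k → k ℕ.< n → ∣ f k ∣ ≤ c) → ∣ ∑< n f ∣ ≤ fromℕ n * c
∣∑<∣-≤ zero    f c _    = ≤-reflexive (sym (*-zeroˡ c))
∣∑<∣-≤ (suc n) f c ∣f∣≤c = begin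
  ∣ ∑< n f + f n ∣          ≤⟨ ∣p+q∣≤∣p∣+∣q∣ (∑< n f) (f n) ⟩
  ∣ ∑< n f ∣ + ∣ f n ∣      ≤⟨ +-mono-≤ (∣∑<∣-≤ n f c (λ k k<n → ∣f∣≤c k (ℕ.m<n⇒m<1+n k<n))) (∣f∣≤c n (ℕ.n<1+n n)) ⟩
  fromℕ n * c + c           ≡⟨ solve 2 (λ n c → n :* c :+ c := (κ 1 :+ n) :* c) refl (fromℕ n) c ⟩
  (1ℚ + fromℕ n) * c        ≡⟨ cong (_* c) (fromℕ-suc n) ⟨
  fromℕ (suc n) * c         ∎
  where open ≤-Reasoning

∣sgn∣ : ∀ k → ∣ sgn k ∣ ≡ 1ℚ
∣sgn∣ zero    = refl
∣sgn∣ (suc k) = trans (∣p*q∣≡∣p∣*∣q∣ (- 1ℚ) (sgn k)) (cong (1ℚ *_) (∣sgn∣ k))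

*-mono-≤-nonNeg : ∀ {p q r s} → 0ℚ ≤ p → 0ℚ ≤ s → p ≤ q → r ≤ s → p * r ≤ q * s
*-mono-≤-nonNeg {p} {q} {r} {s} 0≤p 0≤s p≤q r≤s =
  ≤-trans (*-monoˡ-≤-nonNeg p {{nonNegative 0≤p}} r≤s) (*-monoʳ-≤-nonNeg s {{nonNegative 0≤s}} p≤q)

fromℕ-mono-≤ : ∀ {m n} → m ℕ.≤ n → fromℕ m ≤ fromℕ n
fromℕ-mono-≤ {m} {n} m≤n = begin
  fromℕ m                       ≡⟨ +-identityʳ (fromℕ m) ⟨
  fromℕ m + 0ℚ                  ≤⟨ +-monoʳ-≤ (fromℕ m) (0≤fromℕ (n ℕ.∸ m)) ⟩
  fromℕ m + fromℕ (n ℕ.∸ m)     ≡⟨ fromℕ-+ m (n ℕ.∸ m) ⟨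
  fromℕ (m ℕ.+ (n ℕ.∸ m))       ≡⟨ cong fromℕ (ℕ.m+[n∸m]≡n m≤n) ⟩
  fromℕ n                       ∎
  where open ≤-Reasoning

0≤1/ : ∀ n .{{_ : ℕ.NonZero n}} → 0ℚ ≤ ℤ.+ 1 / n
0≤1/ n = nonNegative⁻¹ (ℤ.+ 1 / n) {{normalize-nonNeg 1 n}}

reciprocal-antimono : ∀ m n .{{_ : ℕ.NonZero m}} .{{_ : ℕ.NonZero n}} → m ℕ.≤ n → ℤ.+ 1 / n ≤ ℤ.+ 1 / m
reciprocal-antimono m n m≤n = begin
  b                    ≡⟨ *-identityˡ b ⟨
  1ℚ * b               ≡⟨ cong (_* b) (*-reciprocal m) ⟨
  fromℕ m * a * b      ≤⟨ *-mono-≤-nonNeg (0≤p*q (0≤fromℕ m) (0≤1/ m)) (0≤1/ n)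
                            (*-mono-≤-nonNeg (0≤fromℕ m) (0≤1/ m) (fromℕ-mono-≤ m≤n) ≤-refl) ≤-refl ⟩
  fromℕ n * a * b      ≡⟨ solve 3 (λ n a b → n :* a :* b := n :* b :* a) refl (fromℕ n) a b ⟩
  fromℕ n * b * a      ≡⟨ cong (_* a) (*-reciprocal n) ⟩
  1ℚ * a               ≡⟨ *-identityˡ a ⟩
  a                    ∎
  where
  open ≤-Reasoning
  a b : ℚ
  a = ℤ.+ 1 / m
  b = ℤ.+ 1 / n

archimedean : ∀ ε → 0ℚ < ε → ∃[ n ] (ℤ.+ 1 / suc n ≤ ε)
archimedean (mkℚ (ℤ.+ zero)    _ _) (*<* (ℤ.+<+ ()))
archimedean (mkℚ ℤ.-[1+ _ ]    _ _) (*<* ())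
-- The denominator of ε is `suc d` and its numerator is at least 1.
archimedean (mkℚ (ℤ.+ (suc a)) d _) _ = d , toℚᵘ-cancel-≤ (begin
  toℚᵘ (ℤ.+ 1 / suc d)     ≃⟨ toℚᵘ-fromℚᵘ (ℤ.+ 1 ℚᵘ./ suc d) ⟩
  ℤ.+ 1 ℚᵘ./ suc d         ≤⟨ ℚᵘ.*≤* (ℤ.*-monoʳ-≤-nonNeg (ℤ.+ suc d) {ℤ.+ 1} {ℤ.+ suc a} (ℤ.+≤+ (ℕ.s≤s ℕ.z≤n))) ⟩
  ℚᵘ.mkℚᵘ (ℤ.+ suc a) d    ∎)
  where open ℚᵘ.≤-Reasoning

-- Error caused by truncated columns.

error-complete : ∀ {k} j → j ℕ.< k → sgn j * (odd⁻⁴ j * (column k j - fromℕ 2)) ≡ 0ℚ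
error-complete j j<k = trans (cong (λ z → sgn j * (odd⁻⁴ j * (z - fromℕ 2))) (column-complete j<k))
  (solve 2 (λ s w → s :* (w :* (κ 2 :- κ 2)) := κ 0) refl (sgn j) (odd⁻⁴ j))

-- Here N ≤ 2j, so already (2j + 1)² ≥ 2j + 1 ≥ N + 1, while the column lies between 0 and 2.
error-incomplete : ∀ N j → j ℕ.< N → N ℕ.∸ j ℕ.≤ j →
  ∣ sgn j * (odd⁻⁴ j * (column (N ℕ.∸ j) j - fromℕ 2)) ∣ ≤ (ℤ.+ 1 / suc N) * (ℤ.+ 1 / suc N) * fromℕ 2
error-incomplete N j j<N N∸j≤j = begin
  ∣ sgn j * (odd⁻⁴ j * e) ∣            ≡⟨ ∣p*q∣≡∣p∣*∣q∣ (sgn j) (odd⁻⁴ j * e) ⟩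
  ∣ sgn j ∣ * ∣ odd⁻⁴ j * e ∣          ≡⟨ cong (_* ∣ odd⁻⁴ j * e ∣) (∣sgn∣ j) ⟩
  1ℚ * ∣ odd⁻⁴ j * e ∣                 ≡⟨ *-identityˡ ∣ odd⁻⁴ j * e ∣ ⟩
  ∣ odd⁻⁴ j * e ∣                      ≡⟨ ∣p*q∣≡∣p∣*∣q∣ (odd⁻⁴ j) e ⟩
  ∣ odd⁻⁴ j ∣ * ∣ e ∣                  ≡⟨ cong (_* ∣ e ∣) (0≤p⇒∣p∣≡p 0≤w) ⟩
  odd⁻⁴ j * ∣ e ∣                      ≤⟨ *-mono-≤-nonNeg 0≤w (0≤fromℕ 2) w≤ ∣e∣≤2 ⟩
  (ℤ.+ 1 / suc N) * (ℤ.+ 1 / suc N) * fromℕ 2 ∎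
  where
  open ≤-Reasoning
  e : ℚ
  e = column (N ℕ.∸ j) j - fromℕ 2
  0≤odd⁻² : 0ℚ ≤ odd⁻² j
  0≤odd⁻² = 0≤1/ ((1 ℕ.+ 2 ℕ.* j) ℕ.^ 2)
  0≤w : 0ℚ ≤ odd⁻⁴ j
  0≤w = 0≤p*q 0≤odd⁻² 0≤odd⁻²
  1+N≤ : suc N ℕ.≤ (1 ℕ.+ 2 ℕ.* j) ℕ.^ 2
  1+N≤ = ℕ.≤-trans (ℕ.s≤s N≤2j) (ℕ.m≤m*n (1 ℕ.+ 2 ℕ.* j) ((1 ℕ.+ 2 ℕ.* j) ℕ.* 1))
    where
    N≤2j : N ℕ.≤ 2 ℕ.* j
    N≤2j = subst (ℕ._≤ 2 ℕ.* j) (ℕ.m+[n∸m]≡n (ℕ.<⇒≤ j<N))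
      (ℕ.+-monoʳ-≤ j (ℕ.≤-trans N∸j≤j (ℕ.≤-reflexive (sym (ℕ.+-identityʳ j)))))
  odd⁻²≤ : odd⁻² j ≤ ℤ.+ 1 / suc N
  odd⁻²≤ = reciprocal-antimono (suc N) ((1 ℕ.+ 2 ℕ.* j) ℕ.^ 2) 1+N≤
  w≤ : odd⁻⁴ j ≤ (ℤ.+ 1 / suc N) * (ℤ.+ 1 / suc N)
  w≤ = *-mono-≤-nonNeg 0≤odd⁻² (0≤1/ (suc N)) odd⁻²≤ odd⁻²≤
  ∣e∣≤2 : ∣ e ∣ ≤ fromℕ 2
  ∣e∣≤2 = begin
    ∣ e ∣                               ≡⟨ ∣-p∣≡∣p∣ e ⟨
    ∣ - e ∣                             ≡⟨ cong ∣_∣ (solve 1 (λ c → :- (c :- κ 2) := κ 2 :- c) refl c) ⟩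
    ∣ fromℕ 2 - c ∣                     ≡⟨ 0≤p⇒∣p∣≡p (≤-trans (≤-reflexive (sym (+-inverseʳ c))) (+-monoˡ-≤ (- c) (column-≤ (N ℕ.∸ j) j))) ⟩
    fromℕ 2 - c                         ≤⟨ +-monoʳ-≤ (fromℕ 2) (neg-antimono-≤ (0≤column (N ℕ.∸ j) j)) ⟩
    fromℕ 2 - 0ℚ                        ≡⟨⟩
    fromℕ 2                             ∎
    where
    c : ℚ
    c = column (N ℕ.∸ j) j

error-term : ∀ N j → j ℕ.< N →
  ∣ sgn j * (odd⁻⁴ j * (column (N ℕ.∸ j) j - fromℕ 2)) ∣ ≤ (ℤ.+ 1 / suc N) * (ℤ.+ 1 / suc N) * fromℕ 2
error-term N j j<N = [ bound-incomplete , bound-complete ]′ (ℕ.≤-<-connex (N ℕ.∸ j) j)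
  where
  Bounded : Set
  Bounded = ∣ sgn j * (odd⁻⁴ j * (column (N ℕ.∸ j) j - fromℕ 2)) ∣ ≤ (ℤ.+ 1 / suc N) * (ℤ.+ 1 / suc N) * fromℕ 2
  bound-incomplete : N ℕ.∸ j ℕ.≤ j → Bounded
  bound-incomplete = error-incomplete N j j<N
  bound-complete : j ℕ.< N ℕ.∸ j → Bounded
  bound-complete j<N∸j = ≤-trans (≤-reflexive (cong ∣_∣ (error-complete j j<N∸j)))
    (0≤p*q (0≤p*q (0≤1/ (suc N)) (0≤1/ (suc N))) (0≤fromℕ 2))

-- There are N error terms, each at most 2/(N + 1)².
partial-sum-close : ∀ N → ∣ ∑< N summand - fromℕ 2 * β4-partial N ∣ ≤ fromℕ 2 * (ℤ.+ 1 / suc N)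
partial-sum-close N = begin
  ∣ ∑< N summand - fromℕ 2 * β4-partial N ∣
    ≡⟨ cong ∣_∣ (partial-sum-error N) ⟩
  ∣ ∑< N (λ j → sgn j * (odd⁻⁴ j * (column (N ℕ.∸ j) j - fromℕ 2))) ∣
    ≤⟨ ∣∑<∣-≤ N _ (a * a * fromℕ 2) (error-term N) ⟩
  fromℕ N * (a * a * fromℕ 2)
    ≤⟨ *-mono-≤-nonNeg (0≤fromℕ N) (0≤p*q (0≤p*q 0≤a 0≤a) (0≤fromℕ 2)) (fromℕ-mono-≤ (ℕ.n≤1+n N)) ≤-refl ⟩
  fromℕ (suc N) * (a * a * fromℕ 2)
    ≡⟨ solve 2 (λ n a → n :* (a :* a :* κ 2) := n :* a :* (κ 2 :* a)) refl (fromℕ (suc N)) a ⟩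
  fromℕ (suc N) * a * (fromℕ 2 * a)
    ≡⟨ cong (_* (fromℕ 2 * a)) (*-reciprocal (suc N)) ⟩
  1ℚ * (fromℕ 2 * a)
    ≡⟨ *-identityˡ (fromℕ 2 * a) ⟩
  fromℕ 2 * a ∎
  where
  open ≤-Reasoning
  a : ℚ
  a = ℤ.+ 1 / suc N
  0≤a : 0ℚ ≤ a
  0≤a = 0≤1/ (suc N)

-- The budget: 2 · ε/8 for truncation, 2 · ε/8 for the Cauchy bound on β(4), and ε/2 for the gap
-- demanded by `_<ℝ_`.
limit-estimate : ∀ {ε} M n m → ℤ.+ 1 / suc M ≤ ⅛ * ε → M ℕ.≤ n →
  ∣ β4-partial n - β4-partial m ∣ < ⅛ * ε →
  ∣ ∑< n summand - fromℕ 2 * β4-partial m ∣ + ½ * ε ≤ ε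
limit-estimate {ε} M n m 1/M≤ M≤n close = begin
  ∣ P - fromℕ 2 * B′ ∣ + ½ * ε
    ≡⟨ cong (λ z → ∣ z ∣ + ½ * ε) (solve 3 (λ p b c → p :- κ 2 :* c := (p :- κ 2 :* b) :+ κ 2 :* (b :- c)) refl P B B′) ⟩
  ∣ (P - fromℕ 2 * B) + fromℕ 2 * (B - B′) ∣ + ½ * ε
    ≤⟨ +-monoˡ-≤ (½ * ε) (∣p+q∣≤∣p∣+∣q∣ (P - fromℕ 2 * B) (fromℕ 2 * (B - B′))) ⟩
  ∣ P - fromℕ 2 * B ∣ + ∣ fromℕ 2 * (B - B′) ∣ + ½ * ε
    ≡⟨ cong (λ z → ∣ P - fromℕ 2 * B ∣ + z + ½ * ε) (∣p*q∣≡∣p∣*∣q∣ (fromℕ 2) (B - B′)) ⟩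
  ∣ P - fromℕ 2 * B ∣ + fromℕ 2 * ∣ B - B′ ∣ + ½ * ε
    ≤⟨ +-monoˡ-≤ (½ * ε) (+-mono-≤
         (≤-trans (partial-sum-close n) (*-monoˡ-≤-nonNeg (fromℕ 2)
           (≤-trans (reciprocal-antimono (suc M) (suc n) (ℕ.s≤s M≤n)) 1/M≤)))
         (*-monoˡ-≤-nonNeg (fromℕ 2) (<⇒≤ close))) ⟩
  fromℕ 2 * (⅛ * ε) + fromℕ 2 * (⅛ * ε) + ½ * ε
    ≡⟨ solve 1 (λ ε → κ 2 :* (con ⅛ :* ε) :+ κ 2 :* (con ⅛ :* ε) :+ con ½ :* ε := ε) refl ε ⟩
  ε ∎
  where
  open ≤-Reasoning
  P B B′ : ℚ
  P  = ∑< n summand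
  B  = β4-partial n
  B′ = β4-partial m

theorem1p1 : HasSum summand (fromℕ 2 • β4)
theorem1p1 ε 0<ε = M ℕ.⊔ N , λ n M⊔N≤n →
  -- The gap δ is ε/2. The index m of the representing sequence only has to pass the Cauchy index N;
  -- n must also pass M, which controls the truncation.
  ½ * ε , 0<p*q (positive⁻¹ ½) 0<ε , N , λ m N≤m →
    limit-estimate M n m 1/M≤ (ℕ.m⊔n≤o⇒m≤o M N M⊔N≤n)
      (β4-close n m (ℕ.m⊔n≤o⇒n≤o M N M⊔N≤n) N≤m)
  where
  0<⅛ε : 0ℚ < ⅛ * ε
  0<⅛ε = 0<p*q (positive⁻¹ ⅛) 0<ε
  M N : ℕ
  M = proj₁ (archimedean (⅛ * ε) 0<⅛ε)
  N = proj₁ (cauchy β4 (⅛ * ε) 0<⅛ε)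
  1/M≤ : ℤ.+ 1 / suc M ≤ ⅛ * ε
  1/M≤ = proj₂ (archimedean (⅛ * ε) 0<⅛ε)
  β4-close : ∀ m n → N ℕ.≤ m → N ℕ.≤ n → ∣ β4-partial m - β4-partial n ∣ < ⅛ * ε
  β4-close = proj₂ (cauchy β4 (⅛ * ε) 0<⅛ε)
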